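{- Let $P$ be a finite point multiset in $\mathbb{R}^2$, invariant as a multiset under an orientation-reversing affine involution (an affine map $R(x)=Lx+b$ with $R\circ R=\mathrm{id}$ and $\det L<0$), and write $n=|P|$ (counted with multiplicity). For every integer $k$ with $0\le k\le\lfloor n/4\rfloor$, there are two perpendicular lines whose four open sectors contain, in cyclic order, at most $$k,\quad k,\quad \left\lfloor\frac{n-2k}{2}\right\rfloor,\quad \left\lfloor\frac{n-2k}{2}\right\rfloor$$ points of $P$ (counted with multiplicity).
   Context: Two perpendicular lines divide the plane into four open sectors (open quadrants), listed in cyclic order around the intersection point. Points of $P$ lying on the cutting lines belong to no open sector. -}

module Defs where

open import Level using (Level; _⊔_; suc)
open import Algebra.Bundles using (CommutativeRing)
open import Data.List.Base using (List; length; filter; map)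
import Data.List.Relation.Binary.Permutation.Setoid as Permutation
open import Data.Nat.Base using (ℕ)
open import Data.Product.Base using (_×_; _,_; ∃; ∃-syntax)
open import Data.Product.Relation.Binary.Pointwise.NonDependent using (×-setoid)
open import Relation.Binary.Bundles using (Setoid)
open import Relation.Binary.Core using (Rel)
open import Relation.Binary.Structures using (IsStrictTotalOrder)
open import Relation.Nullary.Decidable using (_×-dec_)
open import Relation.Nullary.Negation using (¬_)
open import Relation.Unary using (Pred; Decidable)

-- The real numbers, given by the classical axioms that characterise them up to
-- unique isomorphism: a Dedekind-complete ordered field.  Equality of reals is
-- the setoid equality of the ring.
record CompleteOrderedField (c ℓ₁ ℓ₂ : Level) : Set (suc (c ⊔ ℓ₁ ⊔ ℓ₂)) where
  infix 4 _<_ _≤_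
  field
    commutativeRing : CommutativeRing c ℓ₁

  open CommutativeRing commutativeRing public

  field
    _<_                : Rel Carrier ℓ₂
    isStrictTotalOrder : IsStrictTotalOrder _≈_ _<_

  open IsStrictTotalOrder isStrictTotalOrder public
    using (compare; _≟_; _<?_)

  _≤_ : Rel Carrier ℓ₂
  x ≤ y = ¬ (y < x)

  UpperBound : Pred Carrier (c ⊔ ℓ₁ ⊔ ℓ₂) → Pred Carrier (c ⊔ ℓ₁ ⊔ ℓ₂)
  UpperBound S b = ∀ x → S x → x ≤ b

  Supremum : Pred Carrier (c ⊔ ℓ₁ ⊔ ℓ₂) → Pred Carrier (c ⊔ ℓ₁ ⊔ ℓ₂)
  Supremum S s = UpperBound S s × (∀ b → UpperBound S b → s ≤ b)

  field
    0<1      : 0# < 1#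
    +-mono-< : ∀ x y z → x < y → x + z < y + z
    *-pos    : ∀ x y → 0# < x → 0# < y → 0# < x * y
    inverse  : ∀ x → ¬ (x ≈ 0#) → ∃[ y ] (x * y ≈ 1#)
    complete : ∀ (S : Pred Carrier (c ⊔ ℓ₁ ⊔ ℓ₂)) →
               ∃ S → ∃ (UpperBound S) → ∃ (Supremum S)

module Plane {c ℓ₁ ℓ₂ : Level} (ℝ : CompleteOrderedField c ℓ₁ ℓ₂) where

  open CompleteOrderedField ℝ

  pointSetoid : Setoid c ℓ₁
  pointSetoid = ×-setoid setoid setoid

  open Setoid pointSetoid public
    using () renaming (Carrier to Point; _≈_ to _≈ₚ_)

  -- Finite multisets of points are lists, considered up to permutation (and
  -- up to equality of points).
  open Permutation pointSetoid public
    using () renaming (_↭_ to _≈ₘ_)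

  -- x ↦ L x + b with L = (l₁₁ l₁₂ ; l₂₁ l₂₂) and b = (b₁ , b₂)
  record AffineMap : Set c where
    constructor affine
    field
      l₁₁ l₁₂ l₂₁ l₂₂ b₁ b₂ : Carrier

    apply : Point → Point
    apply (x , y) = (l₁₁ * x + l₁₂ * y + b₁) , (l₂₁ * x + l₂₂ * y + b₂)

    det : Carrier
    det = l₁₁ * l₂₂ - l₁₂ * l₂₁

  open AffineMap public using (apply; det)

  Involution : AffineMap → Set (c ⊔ ℓ₁)
  Involution R = ∀ p → apply R (apply R p) ≈ₚ p

  OrientationReversing : AffineMap → Set ℓ₂
  OrientationReversing R = det R < 0#

  Invariant : AffineMap → List Point → Set (c ⊔ ℓ₁)
  Invariant R P = map (apply R) P ≈ₘ P

  -- The line α x + β y = γ.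
  record Line : Set (c ⊔ ℓ₁) where
    constructor line
    field
      α β γ   : Carrier
      nonzero : ¬ (α ≈ 0# × β ≈ 0#)

    Positive Negative : Pred Point ℓ₂
    Positive (x , y) = γ < α * x + β * y
    Negative (x , y) = α * x + β * y < γ

    positive? : Decidable Positive
    positive? (x , y) = γ <? (α * x + β * y)

    negative? : Decidable Negative
    negative? (x , y) = (α * x + β * y) <? γ

  open Line using (Positive; Negative; positive?; negative?)

  Perpendicular : Line → Line → Set ℓ₁
  Perpendicular l m = Line.α l * Line.α m + Line.β l * Line.β m ≈ 0#

  -- I, II, III, IV is a cyclic order around the intersection point.  Negating
  -- the equation of a line exchanges its two sides, and l and m can be
  -- exchanged, so every cyclic listing of the four sectors of a pair of lines,
  -- with any starting sector and in either direction, arises in this way.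
  data Sector : Set where
    I II III IV : Sector

  InSector : Line → Line → Sector → Pred Point ℓ₂
  InSector l m I   p = Positive l p × Positive m p
  InSector l m II  p = Negative l p × Positive m p
  InSector l m III p = Negative l p × Negative m p
  InSector l m IV  p = Positive l p × Negative m p

  inSector? : ∀ l m s → Decidable (InSector l m s)
  inSector? l m I   p = positive? l p ×-dec positive? m p
  inSector? l m II  p = negative? l p ×-dec positive? m p
  inSector? l m III p = negative? l p ×-dec negative? m p
  inSector? l m IV  p = positive? l p ×-dec negative? m p

  count : Line → Line → Sector → List Point → ℕ
  count l m s P = length (filter (inSector? l m s) P)

{-# OPTIONS --safe #-}
-- Choose a direction w with wᵀ L w = 0, which exists because L has trace 0.  In
-- the orthogonal coordinates X along w and Y along the perpendicular direction,
-- R exchanges the two axes (up to positive scaling and translation).  Turn the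
-- axes by a quarter turn.  In every position cut off the 2k points in front; the
-- bisecting levels of the part in front and of the part behind form two closed
-- intervals.  If these never meet, one is strictly below the other, and which one
-- cannot change during the turn, both alternatives being open conditions.  But R
-- carries the initial position to the final one and reverses the order of the
-- levels.
module Submission where

open import Level using (Level; Lift; lift; lower; _⊔_)
open import Algebra.Bundles using (CommutativeRing)
import Algebra.Properties.AbelianGroup
import Algebra.Properties.CommutativeSemigroup
import Algebra.Properties.Ring
import Algebra.Properties.Semiring.Exp.TCOptimised
import Algebra.Properties.Semiring.Mult.TCOptimised
open import Data.Bool.Base as Bool using ()
import Data.Integer.Base as ℤ
import Data.Integer.Properties as ℤ
open import Data.List.Base using (List; []; _∷_; length; filter; map)
open import Data.List.Membership.Propositional using (_∈_)
open import Data.List.Properties using (length-filter; filter-accept; filter-reject)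
open import Data.List.Relation.Binary.Permutation.Setoid.Properties using (xs↭ys⇒|xs|≡|ys|; filter⁺)
open import Data.List.Relation.Unary.Any using (here; there)
open import Data.Maybe.Base using (nothing)
open import Data.Nat.Base as ℕ using (ℕ; zero; suc; s≤s; z≤n)
open import Data.Nat.DivMod using (_/_; _%_; m≡m%n+[m/n]*n; m/n*n≤m; m%n<n)
import Data.Nat.Properties as ℕ
open import Data.Nat.Tactic.RingSolver using (solve-∀)
open import Data.Product.Base using (_×_; _,_; proj₁; proj₂; ∃; ∃₂; ∃-syntax; map₂)
open import Data.Sum.Base using (_⊎_; inj₁; inj₂; map₁; [_,_]′)
open import Function.Base using (_∘_)
open import Relation.Binary.Definitions using (tri<; tri≈; tri>)
import Relation.Binary.PropositionalEquality as ≡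
open ≡ using (_≡_)
import Relation.Binary.Reasoning.Setoid
import Relation.Binary.Reflection
open import Relation.Binary.Structures using (IsStrictTotalOrder)
open import Relation.Nullary.Decidable using (yes; no; does)
open import Relation.Nullary.Negation using (¬_; contradiction)
open import Relation.Unary using (Pred; Decidable)
open import Relation.Unary.Properties using (U?; _∩?_; ∁?)
open import Tactic.RingSolver.Core.AlmostCommutativeRing using (fromCommutativeRing)
open import Tactic.RingSolver.Core.Expression using (Expr; Κ; Ι; _⊕_; _⊗_; ⊝_; _⊛_; module Eval)
import Tactic.RingSolver.Core.Polynomial.Base
import Tactic.RingSolver.Core.Polynomial.Homomorphism
open import Tactic.RingSolver.Core.Polynomial.Parameters using (Homomorphism)
import Tactic.RingSolver.Core.Polynomial.Semantics
open import Defs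

-- Counting

-- A part may have a whole interval of bisecting levels, so their order is not recorded by a
-- continuous function of the turn. It is recorded by one level and two strict lower bounds on
-- counts of points strictly on one side (`Crossed`). Such bounds survive small turns, whatever the
-- points on the lines do.
--
-- The cut is put at the value of rank 2k, not between two values. It is then determined by the
-- position and moves continuously. Moreover, a point on the cut lies in no sector, so at most n -
-- 2k - 1 points remain behind, and two sectors of floor((n - 2k)/2) points have room for them even
-- if n - 2k is odd.
--
-- The condition wᵀ L w = 0 makes R exchange the axes only up to sign. The two scalings have equal
-- signs because det L < 0; if both are negative, replacing w by its quarter turn makes both
-- positive.

module _ {a} {A : Set a} where

  private variable
    p q r : Level
    P : Pred A p
    Q : Pred A q
    R : Pred A r

  # : Decidable P → List A → ℕ
  # P? xs = length (filter P? xs)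

  #-mono : (P? : Decidable P) (Q? : Decidable Q) (xs : List A) →
           (∀ {x} → x ∈ xs → P x → Q x) → # P? xs ℕ.≤ # Q? xs
  #-mono P? Q? [] P⊆Q = z≤n
  #-mono P? Q? (x ∷ xs) P⊆Q
    with P? x | Q? x | #-mono P? Q? xs (P⊆Q ∘ there)
  ... | yes _  | yes _  | ih = s≤s ih
  ... | yes Px | no ¬Qx | _  = contradiction (P⊆Q (here ≡.refl) Px) ¬Qx
  ... | no  _  | yes _  | ih = ℕ.m≤n⇒m≤1+n ih
  ... | no  _  | no  _  | ih = ih

  #-disjoint : (P? : Decidable P) (Q? : Decidable Q) (R? : Decidable R) (xs : List A) →
               (∀ {x} → P x → R x) → (∀ {x} → Q x → R x) → (∀ {x} → P x → ¬ Q x) →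
               # P? xs ℕ.+ # Q? xs ℕ.≤ # R? xs
  #-disjoint P? Q? R? [] P⊆R Q⊆R P⊥Q = z≤n
  #-disjoint P? Q? R? (x ∷ xs) P⊆R Q⊆R P⊥Q
    with P? x | Q? x | R? x | #-disjoint P? Q? R? xs P⊆R Q⊆R P⊥Q
  ... | yes Px | yes Qx | _      | _  = contradiction Qx (P⊥Q Px)
  ... | yes Px | no _   | no ¬Rx | _  = contradiction (P⊆R Px) ¬Rx
  ... | no _   | yes Qx | no ¬Rx | _  = contradiction (Q⊆R Qx) ¬Rx
  ... | yes _  | no _   | yes _  | ih = s≤s ih
  ... | no _   | yes _  | yes _  | ih rewrite ℕ.+-suc (# P? xs) (# Q? xs) = s≤s ih
  ... | no _   | no _   | yes _  | ih = ℕ.m≤n⇒m≤1+n ih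
  ... | no _   | no _   | no _   | ih = ih

  #-disjoint-length : (P? : Decidable P) (Q? : Decidable Q) (xs : List A) →
                      (∀ {x} → P x → ¬ Q x) → # P? xs ℕ.+ # Q? xs ℕ.≤ length xs
  #-disjoint-length P? Q? xs P⊥Q =
    ℕ.≤-trans (#-disjoint P? Q? U? xs _ _ P⊥Q) (length-filter U? xs)

  #-accept : (P? : Decidable P) {x : A} (xs : List A) → P x → # P? (x ∷ xs) ≡ suc (# P? xs)
  #-accept P? xs Px = ≡.cong length (filter-accept P? Px)

  #-reject : (P? : Decidable P) {x : A} (xs : List A) → ¬ P x → # P? (x ∷ xs) ≡ # P? xs
  #-reject P? xs ¬Px = ≡.cong length (filter-reject P? ¬Px)

  #-∷ : (P? : Decidable P) (x : A) (xs : List A) → # P? xs ℕ.≤ # P? (x ∷ xs)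
  #-∷ P? x xs with P? x
  ... | yes _ = ℕ.n≤1+n _
  ... | no _  = ℕ.≤-refl

  #-filter : (P? : Decidable P) (Q? : Decidable Q) (xs : List A) →
             # Q? (filter P? xs) ≡ # (P? ∩? Q?) xs
  #-filter P? Q? [] = ≡.refl
  #-filter P? Q? (x ∷ xs) with P? x | Q? x in eq | #-filter P? Q? xs
  ... | no _  | _     | ih = ih
  ... | yes _ | yes _ | ih rewrite eq = ≡.cong suc ih
  ... | yes _ | no _  | ih rewrite eq = ih

  #-map : (P? : Decidable P) (f : A → A) (xs : List A) →
          # P? (map f xs) ≡ # (P? ∘ f) xs
  #-map P? f [] = ≡.refl
  #-map P? f (x ∷ xs) with P? (f x)
  ... | yes _ = ≡.cong suc (#-map P? f xs)
  ... | no _  = #-map P? f xs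

-- Ordered fields

-- With ℤ rather than the ring itself as coefficients, the solver sees that 1 - 1 = 0.
module IntegerRingSolver {c ℓ} (R : CommutativeRing c ℓ) where
  open CommutativeRing R
  open Algebra.Properties.Ring ring
  open Algebra.Properties.AbelianGroup +-abelianGroup
    using (⁻¹-∙-comm; ⁻¹-involutive; ε⁻¹≈ε)
  open Algebra.Properties.CommutativeSemigroup +-commutativeSemigroup using (interchange)
  open Algebra.Properties.Semiring.Mult.TCOptimised semiring
    using (1+×; ×-homo-+; ×1-homo-*) renaming (_×_ to _·_)
  open Algebra.Properties.Semiring.Exp.TCOptimised semiring using (^-congˡ)
  open Relation.Binary.Reasoning.Setoid setoid

  fromℤ : ℤ.ℤ → Carrier
  fromℤ (ℤ.+ n)      = n · 1#
  fromℤ (ℤ.-[1+ n ]) = - (suc n · 1#)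

  fromℤ-⊖ : ∀ m n → fromℤ (m ℤ.⊖ n) ≈ m · 1# - n · 1#
  fromℤ-⊖ m       zero    = sym (trans (+-congˡ ε⁻¹≈ε) (+-identityʳ _))
  fromℤ-⊖ zero    (suc n) = sym (+-identityˡ _)
  fromℤ-⊖ (suc m) (suc n) = begin
    fromℤ (suc m ℤ.⊖ suc n)             ≡⟨ ≡.cong fromℤ (ℤ.[1+m]⊖[1+n]≡m⊖n m n) ⟩
    fromℤ (m ℤ.⊖ n)                     ≈⟨ fromℤ-⊖ m n ⟩
    m · 1# - n · 1#                     ≈⟨ +-identityˡ _ ⟨
    0# + (m · 1# - n · 1#)              ≈⟨ +-congʳ (-‿inverseʳ 1#) ⟨
    (1# - 1#) + (m · 1# - n · 1#)       ≈⟨ interchange _ _ _ _ ⟩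
    (1# + m · 1#) + (- 1# - n · 1#)     ≈⟨ +-congˡ (⁻¹-∙-comm _ _) ⟩
    (1# + m · 1#) - (1# + n · 1#)       ≈⟨ +-cong (1+× m 1#) (-‿cong (1+× n 1#)) ⟨
    suc m · 1# - suc n · 1#             ∎

  fromℤ-neg : ∀ i → fromℤ (ℤ.- i) ≈ - fromℤ i
  fromℤ-neg (ℤ.+ zero)   = sym ε⁻¹≈ε
  fromℤ-neg (ℤ.+ suc n)  = refl
  fromℤ-neg (ℤ.-[1+ n ]) = sym (⁻¹-involutive _)

  fromℤ-+ : ∀ i j → fromℤ (i ℤ.+ j) ≈ fromℤ i + fromℤ j
  fromℤ-+ (ℤ.+ m)      (ℤ.+ n)      = ×-homo-+ 1# m n
  fromℤ-+ (ℤ.+ m)      (ℤ.-[1+ n ]) = fromℤ-⊖ m (suc n)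
  fromℤ-+ (ℤ.-[1+ m ]) (ℤ.+ n)      = trans (fromℤ-⊖ n (suc m)) (+-comm _ _)
  fromℤ-+ i@(ℤ.-[1+ m ]) j@(ℤ.-[1+ n ]) = begin
    fromℤ (i ℤ.+ j)                      ≡⟨ ≡.cong fromℤ (ℤ.neg-distrib-+ (ℤ.+ suc m) (ℤ.+ suc n)) ⟨
    fromℤ (ℤ.- (ℤ.+ suc m ℤ.+ ℤ.+ suc n)) ≈⟨ fromℤ-neg (ℤ.+ suc m ℤ.+ ℤ.+ suc n) ⟩
    - fromℤ (ℤ.+ suc m ℤ.+ ℤ.+ suc n)    ≈⟨ -‿cong (×-homo-+ 1# (suc m) (suc n)) ⟩
    - (suc m · 1# + suc n · 1#)          ≈⟨ ⁻¹-∙-comm _ _ ⟨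
    fromℤ i + fromℤ j                    ∎

  fromℤ-*-pos-pos : ∀ m n → fromℤ (ℤ.+ m ℤ.* ℤ.+ n) ≈ m · 1# * n · 1#
  fromℤ-*-pos-pos m n = begin
    fromℤ (ℤ.+ m ℤ.* ℤ.+ n)  ≡⟨ ≡.cong fromℤ (ℤ.pos-* m n) ⟨
    fromℤ (ℤ.+ (m ℕ.* n))    ≈⟨ ×1-homo-* m n ⟩
    m · 1# * n · 1#          ∎

  fromℤ-*-pos : ∀ i n → fromℤ (i ℤ.* ℤ.+ n) ≈ fromℤ i * n · 1#
  fromℤ-*-pos (ℤ.+ m)        n = fromℤ-*-pos-pos m n
  fromℤ-*-pos (ℤ.-[1+ m ]) n = begin
    fromℤ (ℤ.-[1+ m ] ℤ.* ℤ.+ n)      ≡⟨ ≡.cong fromℤ (ℤ.neg-distribˡ-* (ℤ.+ suc m) (ℤ.+ n)) ⟨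
    fromℤ (ℤ.- (ℤ.+ suc m ℤ.* ℤ.+ n)) ≈⟨ fromℤ-neg (ℤ.+ suc m ℤ.* ℤ.+ n) ⟩
    - fromℤ (ℤ.+ suc m ℤ.* ℤ.+ n)     ≈⟨ -‿cong (fromℤ-*-pos-pos (suc m) n) ⟩
    - (suc m · 1# * n · 1#)           ≈⟨ -‿distribˡ-* _ _ ⟩
    - (suc m · 1#) * n · 1#           ∎

  fromℤ-* : ∀ i j → fromℤ (i ℤ.* j) ≈ fromℤ i * fromℤ j
  fromℤ-* i (ℤ.+ n)      = fromℤ-*-pos i n
  fromℤ-* i (ℤ.-[1+ n ]) = begin
    fromℤ (i ℤ.* ℤ.-[1+ n ])      ≡⟨ ≡.cong fromℤ (ℤ.neg-distribʳ-* i (ℤ.+ suc n)) ⟨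
    fromℤ (ℤ.- (i ℤ.* ℤ.+ suc n)) ≈⟨ fromℤ-neg (i ℤ.* ℤ.+ suc n) ⟩
    - fromℤ (i ℤ.* ℤ.+ suc n)     ≈⟨ -‿cong (fromℤ-*-pos i (suc n)) ⟩
    - (fromℤ i * suc n · 1#)      ≈⟨ -‿distribʳ-* _ _ ⟩
    fromℤ i * - (suc n · 1#)      ∎

  private
    homomorphism : Homomorphism _ _ _ _
    homomorphism = record
      { from = record
        { rawRing = ℤ.+-*-rawRing
        ; isZero  = λ i → does (i ℤ.≟ ℤ.0ℤ)
        }
      ; to = fromCommutativeRing R (λ _ → nothing)
      ; morphism = record
        { ⟦_⟧    = fromℤ
        ; +-homo = fromℤ-+
        ; *-homo = fromℤ-*
        ; -‿homo = fromℤ-neg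
        ; 0-homo = refl
        ; 1-homo = refl
        }
      ; Zero-C⟶Zero-R = zero-homo
      }
      where
      zero-homo : ∀ i → Bool.T (does (i ℤ.≟ ℤ.0ℤ)) → 0# ≈ fromℤ i
      zero-homo i i≟0 with i ℤ.≟ ℤ.0ℤ
      ... | yes ≡.refl = refl

    open Tactic.RingSolver.Core.Polynomial.Base (Homomorphism.from homomorphism)
    open Tactic.RingSolver.Core.Polynomial.Semantics homomorphism renaming (⟦_⟧ to ⟦_⟧ₚ)
    open Tactic.RingSolver.Core.Polynomial.Homomorphism homomorphism
    open Eval rawRing fromℤ

    normalise : ∀ {n} → Expr ℤ.ℤ n → Poly n
    normalise (Κ x)   = κ x
    normalise (Ι x)   = ι x
    normalise (x ⊕ y) = normalise x ⊞ normalise y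
    normalise (x ⊗ y) = normalise x ⊠ normalise y
    normalise (⊝ x)   = ⊟ normalise x
    normalise (x ⊛ i) = normalise x ⊡ i

    correct : ∀ {n} (e : Expr ℤ.ℤ n) ρ → ⟦ normalise e ⟧ₚ ρ ≈ ⟦ e ⟧ ρ
    correct (Κ x)   ρ = κ-hom x ρ
    correct (Ι x)   ρ = ι-hom x ρ
    correct (x ⊕ y) ρ = trans (⊞-hom (normalise x) (normalise y) ρ) (+-cong (correct x ρ) (correct y ρ))
    correct (x ⊗ y) ρ = trans (⊠-hom (normalise x) (normalise y) ρ) (*-cong (correct x ρ) (correct y ρ))
    correct (⊝ x)   ρ = trans (⊟-hom (normalise x) ρ) (-‿cong (correct x ρ))
    correct (x ⊛ i) ρ = trans (⊡-hom (normalise x) i ρ) (^-congˡ i (correct x ρ))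

  open Relation.Binary.Reflection setoid Ι ⟦_⟧ (λ e → ⟦ normalise e ⟧ₚ) correct public
    using (solve) renaming (_⊜_ to _:=_)

  infixl 6 _:+_ _:-_
  infixl 7 _:*_
  infix  8 :-_

  _:+_ _:*_ _:-_ : ∀ {n} → Expr ℤ.ℤ n → Expr ℤ.ℤ n → Expr ℤ.ℤ n
  _:+_ = _⊕_
  _:*_ = _⊗_
  x :- y = x ⊕ ⊝ y

  :-_ : ∀ {n} → Expr ℤ.ℤ n → Expr ℤ.ℤ n
  :-_ = ⊝_

  :0 :1 : ∀ {n} → Expr ℤ.ℤ n
  :0 = Κ (ℤ.+ 0)
  :1 = Κ (ℤ.+ 1)

module OrderedField {c ℓ₁ ℓ₂} (ℝ : CompleteOrderedField c ℓ₁ ℓ₂) where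
  open CompleteOrderedField ℝ
  open IsStrictTotalOrder isStrictTotalOrder public
    using (asym; irrefl; <-respˡ-≈; <-respʳ-≈) renaming (trans to <-trans)
  open IntegerRingSolver commutativeRing public
    using (solve; _:+_; _:*_; _:-_; :-_; _:=_; :0; :1)

  -- Strict inequalities are proved by exhibiting the difference of the two
  -- sides as a combination of positive quantities.
  <-by : ∀ {x y d} → 0# < d → d ≈ y - x → x < y
  <-by {x} {y} {d} 0<d d≈y-x =
    <-respˡ-≈ (+-identityˡ x)
      (<-respʳ-≈ (trans (+-congʳ d≈y-x) (solve 2 (λ x y → (y :- x) :+ x := y) refl x y))
        (+-mono-< 0# d x 0<d))

  0<y-x : ∀ {x y} → x < y → 0# < y - x
  0<y-x {x} {y} x<y = <-respˡ-≈ (-‿inverseʳ x) (+-mono-< x y (- x) x<y)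

  0<+ : ∀ {x y} → 0# < x → 0# < y → 0# < x + y
  0<+ {x} {y} 0<x 0<y =
    <-trans 0<y (<-respˡ-≈ (+-identityˡ y) (+-mono-< 0# x y 0<x))

  0<* : ∀ {x y} → 0# < x → 0# < y → 0# < x * y
  0<* = *-pos _ _

  ≤-reflexive : ∀ {x y} → x ≈ y → x ≤ y
  ≤-reflexive x≈y = irrefl (sym x≈y)

  <⇒≤ : ∀ {x y} → x < y → x ≤ y
  <⇒≤ = asym

  ≤-<-trans : ∀ {x y z} → x ≤ y → y < z → x < z
  ≤-<-trans {x} {y} x≤y y<z with compare x y
  ... | tri< x<y _ _ = <-trans x<y y<z
  ... | tri≈ _ x≈y _ = <-respˡ-≈ (sym x≈y) y<z
  ... | tri> _ _ y<x = contradiction y<x x≤y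

  <-≤-trans : ∀ {x y z} → x < y → y ≤ z → x < z
  <-≤-trans {y = y} {z} x<y y≤z with compare y z
  ... | tri< y<z _ _ = <-trans x<y y<z
  ... | tri≈ _ y≈z _ = <-respʳ-≈ y≈z x<y
  ... | tri> _ _ z<y = contradiction z<y y≤z

  ≰⇒> : ∀ {x y} → ¬ (x ≤ y) → y < x
  ≰⇒> {x} {y} x≰y with y <? x
  ... | yes y<x = y<x
  ... | no  x≤y = contradiction x≤y x≰y

  ≤-trans : ∀ {x y z} → x ≤ y → y ≤ z → x ≤ z
  ≤-trans x≤y y≤z z<x = x≤y (≤-<-trans y≤z z<x)

  0<*-neg : ∀ {x y} → x < 0# → y < 0# → 0# < x * y
  0<*-neg {x} {y} x<0 y<0 =
    <-respʳ-≈ (solve 2 (λ x y → (:0 :- x) :* (:0 :- y) := x :* y) refl x y)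
      (0<* (0<y-x x<0) (0<y-x y<0))

  x≤y⇒x-y≤0 : ∀ {x y} → x ≤ y → x - y ≤ 0#
  x≤y⇒x-y≤0 {x} {y} x≤y 0<x-y =
    x≤y (<-by 0<x-y refl)

  x≤y⇒-[y-x]≤0 : ∀ {x y} → x ≤ y → - (y - x) ≤ 0#
  x≤y⇒-[y-x]≤0 {x} {y} x≤y 0<d =
    x≤y (<-by 0<d (solve 2 (λ x y → :- (y :- x) := x :- y) refl x y))

  0<x² : ∀ {x} → ¬ (x ≈ 0#) → 0# < x * x
  0<x² {x} x≉0 with compare x 0#
  ... | tri< x<0 _ _ = 0<*-neg x<0 x<0
  ... | tri≈ _ x≈0 _ = contradiction x≈0 x≉0
  ... | tri> _ _ 0<x = 0<* 0<x 0<x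

  0≤x² : ∀ x → 0# ≤ x * x
  0≤x² x with x ≟ 0#
  ... | yes x≈0 = ≤-reflexive (sym (trans (*-congʳ x≈0) (zeroˡ x)))
  ... | no  x≉0 = <⇒≤ (0<x² x≉0)

  0<x²+y² : ∀ {x y} → ¬ (x ≈ 0# × y ≈ 0#) → 0# < x * x + y * y
  0<x²+y² {x} {y} xy≉0 with x ≟ 0#
  ... | no  x≉0 = ≤-<-trans (0≤x² y)
                    (<-by (0<x² x≉0) (solve 2 (λ a b → a := (a :+ b) :- b) refl (x * x) (y * y)))
  ... | yes x≈0 = ≤-<-trans (0≤x² x)
                    (<-by (0<x² (λ y≈0 → xy≉0 (x≈0 , y≈0)))
                      (solve 2 (λ a b → b := (a :+ b) :- a) refl (x * x) (y * y)))

  1-t,t≉0 : ∀ t → ¬ (1# - t ≈ 0# × t ≈ 0#)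
  1-t,t≉0 t (1-t≈0 , t≈0) = irrefl refl (<-respʳ-≈
    (trans (solve 1 (λ t → :1 := (:1 :- t) :+ t) refl t)
      (trans (+-cong 1-t≈0 t≈0) (+-identityˡ 0#))) 0<1)

  reciprocal : ∀ {x} → 0# < x → ∃[ y ] 0# < y × x * y ≈ 1#
  reciprocal {x} 0<x with inverse x (λ x≈0 → irrefl (sym x≈0) 0<x)
  ... | y , xy≈1 = y , 0<y , xy≈1
    where
    0<y : 0# < y
    0<y with compare y 0#
    ... | tri> _ _ 0<y = 0<y
    ... | tri≈ _ y≈0 _ =
      contradiction 0<1 (irrefl (trans (sym (zeroʳ x)) (trans (*-congˡ (sym y≈0)) xy≈1)))
    ... | tri< y<0 _ _ =
      contradiction (<-trans 0<1 1<0) (irrefl refl)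
      where
      1<0 : 1# < 0#
      1<0 = <-by (0<* 0<x (0<y-x y<0))
              (trans (solve 2 (λ x y → x :* (:0 :- y) := :0 :- x :* y) refl x y)
                     (+-congˡ (-‿cong xy≈1)))

  slack : ∀ {v} → 0# < v → ∃[ ε ] 0# < ε × ε + ε < v
  slack {v} 0<v =
    let r , 0<r , 3r≈1 = reciprocal (0<+ (0<+ 0<1 0<1) 0<1) in
    -- A third of `v`, since twice the slack must stay strictly below `v`.
    v * r , 0<* 0<v 0<r ,
    <-by (0<* 0<v 0<r)
      (trans (solve 2 (λ v r → v :* r := v :* ((:1 :+ :1 :+ :1) :* r) :- (v :* r :+ v :* r)) refl v r)
             (+-congʳ (trans (*-congˡ 3r≈1) (*-identityʳ v))))

  minus-cong : ∀ {x y z w} → x ≈ y → z ≈ w → x - z ≈ y - w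
  minus-cong x≈y z≈w = +-cong x≈y (-‿cong z≈w)

  affine-mono : ∀ {a x y} b → 0# < a → x < y → a * x + b < a * y + b
  affine-mono {a} {x} {y} b 0<a x<y = <-by (0<* 0<a (0<y-x x<y))
    (solve 4 (λ a b x y → a :* (y :- x) := (a :* y :+ b) :- (a :* x :+ b)) refl a b x y)

  affine-cancel : ∀ {a x y} b → 0# < a → a * x + b < a * y + b → x < y
  affine-cancel {x = x} {y} b 0<a ax+b<ay+b with compare x y
  ... | tri< x<y _ _ = x<y
  ... | tri≈ _ x≈y _ = contradiction ax+b<ay+b (irrefl (+-congʳ (*-congˡ x≈y)))
  ... | tri> _ _ y<x = contradiction ax+b<ay+b (asym (affine-mono b 0<a y<x))

  0<*-cancelˡ : ∀ {x y} → 0# < x → 0# < x * y → 0# < y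
  0<*-cancelˡ {x} {y} 0<x 0<xy = affine-cancel 0# 0<x
    (<-by 0<xy (solve 2 (λ x y → x :* y := (x :* y :+ :0) :- (x :* :0 :+ :0)) refl x y))

  0<-x : ∀ {x} → x < 0# → 0# < - x
  0<-x {x} x<0 = <-respʳ-≈ (+-identityˡ (- x)) (0<y-x x<0)

  neg-mono : ∀ {x y} → x < y → - y < - x
  neg-mono {x} {y} x<y = <-by (0<y-x x<y) (solve 2 (λ x y → y :- x := (:- x) :- (:- y)) refl x y)

  common-slack : ∀ {u v} → 0# < u → 0# < v → ∃[ ε ] 0# < ε × ε ≤ u × ε ≤ v
  common-slack {u} {v} 0<u 0<v with u <? v
  ... | yes u<v = u , 0<u , irrefl refl , <⇒≤ u<v
  ... | no  v≤u = v , 0<v , v≤u , irrefl refl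

  -- Stands for |m| < M, without an absolute value.
  Bounded : Carrier → Carrier → Set ℓ₂
  Bounded M m = m < M × - m < M

  bound : ∀ m → ∃[ M ] 0# < M × Bounded M m
  bound m with compare 0# m
  ... | tri< 0<m _ _ = m + m , 0<+ 0<m 0<m ,
    <-by 0<m (solve 1 (λ m → m := (m :+ m) :- m) refl m) ,
    <-by (0<+ 0<m (0<+ 0<m 0<m)) (solve 1 (λ m → m :+ (m :+ m) := (m :+ m) :- (:- m)) refl m)
  ... | tri≈ _ 0≈m _ = 1# , 0<1 , <-respˡ-≈ 0≈m 0<1 ,
    <-by 0<1 (trans (solve 0 (:1 := :1 :- (:- :0)) refl) (+-congˡ (-‿cong (-‿cong 0≈m))))
  ... | tri> _ _ m<0 = - m - m ,
    <-by (0<+ 0<-m 0<-m) (solve 1 (λ m → (:0 :- m) :+ (:0 :- m) := (:- m :- m) :- :0) refl m) ,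
    <-by (0<+ 0<-m (0<+ 0<-m 0<-m))
      (solve 1 (λ m → (:0 :- m) :+ ((:0 :- m) :+ (:0 :- m)) := (:- m :- m) :- m) refl m) ,
    <-by 0<-m (solve 1 (λ m → :0 :- m := (:- m :- m) :- (:- m)) refl m)
    where
    0<-m : 0# < 0# - m
    0<-m = 0<y-x m<0

  bounded-mono : ∀ {M N m} → M ≤ N → Bounded M m → Bounded N m
  bounded-mono M≤N (m<M , -m<M) = <-≤-trans m<M M≤N , <-≤-trans -m<M M≤N

  bounded-resp : ∀ {M m n} → m ≈ n → Bounded M m → Bounded M n
  bounded-resp m≈n (m<M , -m<M) = <-respˡ-≈ m≈n m<M , <-respˡ-≈ (-‿cong m≈n) -m<M

  bounded-+ : ∀ {M N m n} → Bounded M m → Bounded N n → Bounded (M + N) (m + n)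
  bounded-+ {M} {N} {m} {n} (m<M , -m<M) (n<N , -n<N) =
    <-by (0<+ (0<y-x m<M) (0<y-x n<N))
      (solve 4 (λ M N m n → (M :- m) :+ (N :- n) := (M :+ N) :- (m :+ n)) refl M N m n) ,
    <-by (0<+ (0<y-x -m<M) (0<y-x -n<N))
      (solve 4 (λ M N m n → (M :- (:- m)) :+ (N :- (:- n)) := (M :+ N) :- (:- (m :+ n))) refl M N m n)

  half-pos : ∀ {x} → 0# < x + x → 0# < x
  half-pos {x} 0<x+x with compare 0# x
  ... | tri< 0<x _ _ = 0<x
  ... | tri≈ _ 0≈x _ = contradiction 0<x+x
    (irrefl (trans (sym (+-identityʳ 0#)) (+-cong 0≈x 0≈x)))
  ... | tri> _ _ x<0 = contradiction 0<x+x (<⇒≤ (<-by (0<+ (0<y-x x<0) (0<y-x x<0))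
    (solve 1 (λ x → (:0 :- x) :+ (:0 :- x) := :0 :- (x :+ x)) refl x)))

  -- Stated for every `δ ≤ ε`, so that the slacks of finitely many points can be replaced by their
  -- minimum.
  separation : ∀ {x y} → x < y → ∃[ ε ] 0# < ε × (∀ {δ} → δ ≤ ε → x + (δ + δ) < y)
  separation {x} {y} x<y =
    let ε , 0<ε , 2ε<y-x = slack (0<y-x x<y) in
    ε , 0<ε , λ {δ} δ≤ε → ≤-<-trans
      (λ 2ε<2δ → δ≤ε (<-by (half-pos (<-respʳ-≈
        (solve 3 (λ x δ ε → (x :+ (δ :+ δ)) :- (x :+ (ε :+ ε)) := (δ :- ε) :+ (δ :- ε)) refl x δ ε)
        (0<y-x 2ε<2δ))) refl))
      (<-by (0<y-x 2ε<y-x)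
        (solve 3 (λ x y ε → (y :- x) :- (ε :+ ε) := y :- (x :+ (ε :+ ε))) refl x y ε))

  -- (M - m)(N + n) + (M + m)(N - n) is twice MN - mn and has positive terms; changing the sign of n
  -- gives the other bound.
  bounded-* : ∀ {M N m n} → Bounded M m → Bounded N n → Bounded (M * N) (m * n)
  bounded-* {M} {N} {m} {n} (m<M , -m<M) (n<N , -n<N) =
    <-by (half-pos (<-respʳ-≈
        (solve 4 (λ M N m n → (M :- m) :* (N :- (:- n)) :+ (M :- (:- m)) :* (N :- n)
                           := (M :* N :- m :* n) :+ (M :* N :- m :* n)) refl M N m n)
        (0<+ (0<* (0<y-x m<M) (0<y-x -n<N)) (0<* (0<y-x -m<M) (0<y-x n<N))))) refl ,
    <-by (half-pos (<-respʳ-≈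
        (solve 4 (λ M N m n → (M :- m) :* (N :- n) :+ (M :- (:- m)) :* (N :- (:- n))
                           := (M :* N :- (:- (m :* n))) :+ (M :* N :- (:- (m :* n)))) refl M N m n)
        (0<+ (0<* (0<y-x m<M) (0<y-x n<N)) (0<* (0<y-x -m<M) (0<y-x -n<N))))) refl

  -- The bound `δ ≤ 1` serves the quadratic form below, whose difference quotient contains the
  -- increment itself.
  shrink : ∀ {M η} → 0# < M → 0# < η →
           ∃[ δ ] 0# < δ × δ ≤ 1# × (∀ {τ m} → Bounded δ τ → Bounded M m → Bounded η (τ * m))
  shrink {M} {η} 0<M 0<η =
    let r , 0<r , Mr≈1 = reciprocal 0<M
        δ , 0<δ , δ≤1 , δ≤ηr = common-slack 0<1 (0<* 0<η 0<r)
        ηrM≈η = trans (solve 3 (λ η r M → η :* r :* M := η :* (M :* r)) refl η r M)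
                      (trans (*-congˡ Mr≈1) (*-identityʳ η))
    in δ , 0<δ , δ≤1 , λ Bτ Bm →
         bounded-mono (≤-reflexive ηrM≈η) (bounded-* (bounded-mono δ≤ηr Bτ) Bm)

  separated-stable : ∀ {x y x′ y′ ε} → x + (ε + ε) < y →
                     Bounded ε (x′ - x) → Bounded ε (y′ - y) → x′ < y′
  separated-stable {x} {y} {x′} {y′} {ε} x+2ε<y (x′-x<ε , _) (_ , y-y′<ε) =
    <-by (0<+ (0<y-x x+2ε<y) (0<+ (0<y-x x′-x<ε) (0<y-x y-y′<ε)))
      (solve 5 (λ x y x′ y′ ε → (y :- (x :+ (ε :+ ε))) :+ ((ε :- (x′ :- x)) :+ (ε :- (:- (y′ :- y))))
                              := y′ :- x′) refl x y x′ y′ ε)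

  bounded-0 : ∀ {ε x} → 0# < ε → Bounded ε (x - x)
  bounded-0 {ε} {x} 0<ε =
    <-respˡ-≈ (solve 1 (λ x → :0 := x :- x) refl x) 0<ε ,
    <-respˡ-≈ (solve 1 (λ x → :0 := :- (x :- x)) refl x) 0<ε

  -- Open sets of reals and connectedness of the unit interval

  Open : ∀ {u} → Pred Carrier u → Set (c ⊔ ℓ₂ ⊔ u)
  Open U = ∀ t → U t → ∃[ ε ] 0# < ε × (∀ t′ → Bounded ε (t′ - t) → U t′)

  -- Suprema exist for predicates of one fixed level, to which the set used in `connected` has to be
  -- lifted.
  open-lift : ∀ {u} {U : Pred Carrier u} → Open U → Open (λ t → Lift (c ⊔ ℓ₁ ⊔ ℓ₂) (U t))
  open-lift open-U t (lift Ut) =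
    let ε , 0<ε , near = open-U t Ut in ε , 0<ε , λ t′ Bε → lift (near t′ Bε)

  -- The supremum t of the points of U up to 1 lies neither in U nor in V.
  connected : ∀ {v s} {U : Pred Carrier (c ⊔ ℓ₁ ⊔ ℓ₂)} {V : Pred Carrier v} {S : Pred Carrier s} →
              Open U → Open V → (∀ t → U t → ¬ V t) → U 0# → V 1# →
              (∀ t → U t ⊎ V t ⊎ S t) → ∃ S
  connected {U = U} {V} {S} open-U open-V disjoint U0 V1 cases = result
    where
    T : Pred Carrier _
    T t = U t × t ≤ 1#

    sup : ∃ (Supremum T)
    sup = complete T (0# , U0 , <⇒≤ 0<1) (1# , λ _ → proj₂)

    t : Carrier
    t = proj₁ sup

    t-upper : UpperBound T t
    t-upper = proj₁ (proj₂ sup)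

    t-least : ∀ b → UpperBound T b → t ≤ b
    t-least = proj₂ (proj₂ sup)

    t≤1 : t ≤ 1#
    t≤1 = t-least 1# (λ _ → proj₂)

    ¬Ut : ¬ U t
    ¬Ut Ut with open-U t Ut
    -- If the neighbourhood of `t` reaches past 1, then 1 lies in `U` as well as in `V`; otherwise
    -- `t + η` is an element of `T` above its supremum.
    ... | ε , 0<ε , near with 1# <? t + ε
    ...   | yes 1<t+ε = disjoint 1# (near 1#
            ( <-by (0<y-x 1<t+ε) (solve 2 (λ t ε → (t :+ ε) :- :1 := ε :- (:1 :- t)) refl t ε)
            , ≤-<-trans (x≤y⇒-[y-x]≤0 t≤1) 0<ε)) V1
    ...   | no  t+ε≤1 with slack 0<ε
    ...     | η , 0<η , 2η<ε = t-upper (t + η) (near (t + η)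
              ( <-respˡ-≈ (solve 2 (λ t η → η := (t :+ η) :- t) refl t η) η<ε
              , <-by (0<+ 0<η (<-trans 0<η η<ε))
                  (solve 3 (λ t η ε → η :+ ε := ε :- (:- ((t :+ η) :- t))) refl t η ε))
              , ≤-trans (<⇒≤ (<-by (0<y-x η<ε)
                  (solve 3 (λ t η ε → ε :- η := (t :+ ε) :- (t :+ η)) refl t η ε))) t+ε≤1)
              (<-by 0<η (solve 2 (λ t η → η := (t :+ η) :- t) refl t η))
              where
              η<ε : η < ε
              η<ε = <-trans (<-by 0<η (solve 1 (λ η → η := (η :+ η) :- η) refl η)) 2η<ε

    ¬Vt : ¬ V t
    ¬Vt Vt with open-V t Vt
    -- An element of `T` above `t - ε` would be within `ε` of `t`, hence in `V`; so `t - ε` is a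
    -- smaller upper bound.
    ... | ε , 0<ε , near = t-least (t - ε)
      (λ x (Ux , x≤1) t-ε<x → disjoint x Ux (near x
        ( ≤-<-trans (x≤y⇒x-y≤0 (t-upper x (Ux , x≤1))) 0<ε
        , <-by (0<y-x t-ε<x) (solve 3 (λ t ε x → x :- (t :- ε) := ε :- (:- (x :- t))) refl t ε x))))
      (<-by 0<ε (solve 2 (λ t ε → ε := t :- (t :- ε)) refl t ε))

    result : ∃ S
    result with cases t
    ... | inj₁ Ut        = contradiction Ut ¬Ut
    ... | inj₂ (inj₁ Vt) = contradiction Vt ¬Vt
    ... | inj₂ (inj₂ St) = t , St

-- Order statistics

module OrderStatistics {c ℓ₁ ℓ₂} (ℝ : CompleteOrderedField c ℓ₁ ℓ₂) {a} {A : Set a} where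
  open CompleteOrderedField ℝ hiding (zero)
  open OrderedField ℝ

  module _ (h : A → Carrier) (s : Carrier) where
    Above Below : Pred A ℓ₂
    Above x = s < h x
    Below x = h x < s

    above? : Decidable Above
    above? x = s <? h x

    below? : Decidable Below
    below? x = h x <? s

    notBelow? : Decidable (¬_ ∘ Below)
    notBelow? = ∁? below?

  -- Characterises the value of rank `r` in decreasing order, counted from 0 and with ties, by two
  -- counts instead of a sorted list.
  Selects : (A → Carrier) → List A → ℕ → Carrier → Set
  Selects h xs r s = # (above? h s) xs ℕ.≤ r × r ℕ.< # (notBelow? h s) xs

  -- A new entry not above the old value of rank `r` leaves it in place. Otherwise the answer is the
  -- smaller of the new entry and the old value of rank `r - 1`, or the new entry itself if `r` is
  -- 0.
  select : ∀ h xs {r} → r ℕ.< length xs → ∃ (Selects h xs r)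
  select h (x ∷ xs) {r} r<n with largest-after
    where
    -- The statistic of rank r is unchanged unless x lies above it.
    largest-after : (∃[ s ] Selects h xs r s × h x ≤ s) ⊎ # (above? h (h x)) xs ℕ.≤ r
    largest-after with r ℕ.<? length xs
    ... | no  r≮n = inj₂ (ℕ.≤-trans (length-filter (above? h (h x)) xs) (ℕ.≮⇒≥ r≮n))
    ... | yes r<n with select h xs r<n
    ...   | s , #above≤r , r<#≥ with s <? h x
    ...     | no  x≤s = inj₁ (s , (#above≤r , r<#≥) , x≤s)
    ...     | yes s<x = inj₂ (ℕ.≤-trans
                (#-mono (above? h (h x)) (above? h s) xs (λ _ → <-trans s<x)) #above≤r)
  ... | inj₁ (s , (#above≤r , r<#≥) , x≤s) =
    s , ℕ.≤-trans (ℕ.≤-reflexive (#-reject (above? h s) xs x≤s)) #above≤r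
      , ℕ.≤-trans r<#≥ (#-∷ (notBelow? h s) x xs)
  ... | inj₂ #above≤r with r
  ...   | zero   = h x
    , ℕ.≤-trans (ℕ.≤-reflexive (#-reject (above? h (h x)) xs (irrefl refl))) #above≤r
    , ℕ.≤-trans (s≤s z≤n) (ℕ.≤-reflexive (≡.sym (#-accept (notBelow? h (h x)) xs (irrefl refl))))
  ...   | suc r′ with select h xs (ℕ.s≤s⁻¹ r<n)
  ...     | s , #above≤r′ , r′<#≥ with s <? h x
  ...       | yes s<x = s
    , ℕ.≤-trans (ℕ.≤-reflexive (#-accept (above? h s) xs s<x)) (s≤s #above≤r′)
    , ℕ.≤-trans (s≤s r′<#≥) (ℕ.≤-reflexive (≡.sym (#-accept (notBelow? h s) xs (<⇒≤ s<x))))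
  ...       | no  x≤s = h x
    , ℕ.≤-trans (ℕ.≤-reflexive (#-reject (above? h (h x)) xs (irrefl refl))) #above≤r
    , ℕ.≤-trans (s≤s (ℕ.≤-trans r′<#≥
        (#-mono (notBelow? h s) (notBelow? h (h x)) xs (λ _ s≤y y<x → s≤y (<-≤-trans y<x x≤s)))))
      (ℕ.≤-reflexive (≡.sym (#-accept (notBelow? h (h x)) xs (irrefl refl))))

  module _ (h : A → Carrier) (s : Carrier) where
    -- Twice `ε`, because in a small turn the value of a point and the cut both move, each by less
    -- than `ε`.
    HasGap : Carrier → List A → Set _
    HasGap ε xs = ∀ {x} → x ∈ xs → (h x < s → h x + (ε + ε) < s) × (s < h x → s + (ε + ε) < h x)

    gap : ∀ xs → ∃[ ε ] 0# < ε × (∀ {δ} → δ ≤ ε → HasGap δ xs)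
    gap [] = 1# , 0<1 , λ _ ()
    gap (x ∷ xs) with gap xs | gap₁
      where
      gap₁ : ∃[ ε ] 0# < ε × (∀ {δ} → δ ≤ ε → (h x < s → h x + (δ + δ) < s) × (s < h x → s + (δ + δ) < h x))
      gap₁ with compare (h x) s
      ... | tri< x<s _ s≮x = let ε , 0<ε , apart = separation x<s in
              ε , 0<ε , λ δ≤ε → (λ _ → apart δ≤ε) , (λ s<x → contradiction s<x s≮x)
      ... | tri≈ x≮s _ s≮x = 1# , 0<1 , λ _ → (λ x<s → contradiction x<s x≮s) , (λ s<x → contradiction s<x s≮x)
      ... | tri> x≮s _ s<x = let ε , 0<ε , apart = separation s<x in
              ε , 0<ε , λ δ≤ε → (λ x<s → contradiction x<s x≮s) , (λ _ → apart δ≤ε)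
    ... | ε , 0<ε , ε-gap | ε₁ , 0<ε₁ , ε₁-gap =
      let δ , 0<δ , δ≤ε , δ≤ε₁ = common-slack 0<ε 0<ε₁ in
      δ , 0<δ , λ η≤δ → λ where
        (here ≡.refl) → ε₁-gap (≤-trans η≤δ δ≤ε₁)
        (there y∈xs)  → ε-gap (≤-trans η≤δ δ≤ε) y∈xs

  -- Bisecting levels of two parts of a list

  private variable
    p q : Level
    D : Pred A p
    E : Pred A q

  module _ (g : A → Carrier) (xs : List A) where

    Balanced : Decidable D → ℕ → Carrier → Set
    Balanced D? r s = # (D? ∩? above? g s) xs ℕ.≤ r × # (D? ∩? below? g s) xs ℕ.≤ r

    -- The level s is above all balanced levels of D and below all those of E.
    Crossed : Decidable D → ℕ → Decidable E → ℕ → Set c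
    Crossed D? r E? q = ∃[ s ] r ℕ.< # (D? ∩? below? g s) xs × q ℕ.< # (E? ∩? above? g s) xs

    SelectsIn : Decidable D → ℕ → Carrier → Set
    SelectsIn D? r s = # (D? ∩? above? g s) xs ℕ.≤ r × r ℕ.< # (D? ∩? notBelow? g s) xs

    -- A part of at most `r` points has no value of rank `r`, but every level is balanced for it.
    selectIn : (D? : Decidable D) (r : ℕ) → # D? xs ℕ.≤ r ⊎ ∃ (SelectsIn D? r)
    selectIn D? r with # D? xs ℕ.≤? r
    ... | yes #D≤r = inj₁ #D≤r
    ... | no  #D≰r with select g (filter D? xs) (ℕ.≰⇒> #D≰r)
    ...   | s , #above≤r , r<#≥ = inj₂ (s
            , ℕ.≤-trans (ℕ.≤-reflexive (≡.sym (#-filter D? (above? g s) xs))) #above≤r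
            , ℕ.≤-trans r<#≥ (ℕ.≤-reflexive (#-filter D? (notBelow? g s) xs)))

    few⇒balanced : (D? : Decidable D) {r : ℕ} (s : Carrier) → # D? xs ℕ.≤ r → Balanced D? r s
    few⇒balanced D? s #D≤r =
      ℕ.≤-trans (#-mono (D? ∩? above? g s) D? xs (λ _ → proj₁)) #D≤r ,
      ℕ.≤-trans (#-mono (D? ∩? below? g s) D? xs (λ _ → proj₁)) #D≤r

    -- More than `r` of the at most 2r points lie on or above the level, which leaves no more than
    -- `r` below.
    selectsIn⇒balanced : (D? : Decidable D) {r : ℕ} {s : Carrier} → # D? xs ℕ.≤ r ℕ.+ r →
                         SelectsIn D? r s → Balanced D? r s
    selectsIn⇒balanced D? {r} {s} #D≤2r (#above≤r , r<#≥) = #above≤r , ℕ.+-cancelʳ-≤ r _ _ (begin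
      #below ℕ.+ r                                ≤⟨ ℕ.+-monoʳ-≤ #below (ℕ.<⇒≤ r<#≥) ⟩
      #below ℕ.+ # (D? ∩? notBelow? g s) xs       ≤⟨ #-disjoint (D? ∩? below? g s) (D? ∩? notBelow? g s) D? xs
                                                       proj₁ proj₁ (λ (_ , x<s) (_ , s≤x) → s≤x x<s) ⟩
      # D? xs                                     ≤⟨ #D≤2r ⟩
      r ℕ.+ r                                     ∎)
      where
      open ℕ.≤-Reasoning
      #below = # (D? ∩? below? g s) xs

    -- `a` is the least level with at most `r` points of `D` above it, and `b` plays the same role
    -- for `E`. As `a ≤ b`, the level `b` can fail for `D` only by having too many points of `D`
    -- below; then the balanced levels of `D` end before those of `E` begin.
    balanced-or-crossed : (D? : Decidable D) (E? : Decidable E) {r q : ℕ} {a b : Carrier} →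
      # E? xs ℕ.≤ q ℕ.+ q → SelectsIn D? r a → SelectsIn E? q b → a ≤ b →
      (Balanced D? r b × Balanced E? q b) ⊎ Crossed D? r E? q
    balanced-or-crossed D? E? {r} {q} {a} {b} #E≤2q (#D>a≤r , _) sel-E@(_ , q<#E≥b) a≤b
      with # (D? ∩? below? g b) xs ℕ.≤? r
    ... | yes #D<b≤r = inj₁
            ( ( ℕ.≤-trans (#-mono (D? ∩? above? g b) (D? ∩? above? g a) xs
                             (λ _ (Dx , b<x) → Dx , ≤-<-trans a≤b b<x)) #D>a≤r
              , #D<b≤r)
            , selectsIn⇒balanced E? #E≤2q sel-E)
    ... | no  #D<b≰r with gap g b xs
    -- Just under `b` the points on level `b` count as strictly above, and by the gap no point below
    -- `b` is lost.
    ...   | ε , 0<ε , ε-gap = inj₂ (b - ε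
            , ℕ.≤-trans (ℕ.≰⇒> #D<b≰r) (#-mono (D? ∩? below? g b) (D? ∩? below? g (b - ε)) xs
                (λ {x} x∈xs (Dx , x<b) → Dx ,
                  <-by (0<+ (0<y-x (proj₁ (ε-gap (irrefl refl) x∈xs) x<b)) 0<ε)
                    (solve 3 (λ x b ε → (b :- (x :+ (ε :+ ε))) :+ ε := (b :- ε) :- x) refl (g x) b ε)))
            , ℕ.≤-trans q<#E≥b (#-mono (E? ∩? notBelow? g b) (E? ∩? above? g (b - ε)) xs
                (λ _ (Ex , b≤x) → Ex ,
                  <-≤-trans (<-by 0<ε (solve 2 (λ b ε → ε := b :- (b :- ε)) refl b ε)) b≤x)))

    common-bisector : (D? : Decidable D) (E? : Decidable E) {r q : ℕ} →
      # D? xs ℕ.≤ r ℕ.+ r → # E? xs ℕ.≤ q ℕ.+ q →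
      Crossed D? r E? q ⊎ Crossed E? q D? r ⊎ (∃[ s ] Balanced D? r s × Balanced E? q s)
    common-bisector D? E? {r} {q} #D≤2r #E≤2q with selectIn D? r | selectIn E? q
    ... | inj₁ #D≤r       | inj₁ #E≤q       =
      inj₂ (inj₂ (0# , few⇒balanced D? 0# #D≤r , few⇒balanced E? 0# #E≤q))
    ... | inj₁ #D≤r       | inj₂ (b , sel-E) =
      inj₂ (inj₂ (b , few⇒balanced D? b #D≤r , selectsIn⇒balanced E? #E≤2q sel-E))
    ... | inj₂ (a , sel-D) | inj₁ #E≤q       =
      inj₂ (inj₂ (a , selectsIn⇒balanced D? #D≤2r sel-D , few⇒balanced E? a #E≤q))
    ... | inj₂ (a , sel-D) | inj₂ (b , sel-E) with b <? a
    ...   | no a≤b with balanced-or-crossed D? E? #E≤2q sel-D sel-E a≤b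
    ...     | inj₁ balanced = inj₂ (inj₂ (b , balanced))
    ...     | inj₂ crossed  = inj₁ crossed
    common-bisector D? E? {r} {q} #D≤2r #E≤2q | inj₂ (a , sel-D) | inj₂ (b , sel-E)
          | yes b<a with balanced-or-crossed E? D? #D≤2r sel-E sel-D (<⇒≤ b<a)
    ...     | inj₁ (bal-E , bal-D) = inj₂ (inj₂ (a , bal-D , bal-E))
    ...     | inj₂ crossed = inj₂ (inj₁ crossed)

-- Turning the axes

module Rotation {c ℓ₁ ℓ₂} (ℝ : CompleteOrderedField c ℓ₁ ℓ₂) {a} {A : Set a}
  (X Y : A → CompleteOrderedField.Carrier ℝ) (xs : List A) (k h : ℕ)
  (2k<n : k ℕ.+ k ℕ.< length xs) (n≤2k+1+2h : length xs ℕ.≤ (k ℕ.+ k) ℕ.+ suc (h ℕ.+ h))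
  where
  open CompleteOrderedField ℝ hiding (zero)
  open OrderedField ℝ
  open OrderStatistics ℝ {A = A}

  -- As t runs from 0 to 1, the pair f, g of orthogonal coordinates turns, up
  -- to scaling, from X, Y to Y, - X.
  f g : Carrier → A → Carrier
  f t x = (1# - t) * X x + t * Y x
  g t x = (1# - t) * Y x - t * X x

  front? : ∀ t s → Decidable (Above (f t) s)
  front? t = above? (f t)

  back? : ∀ t s → Decidable (Below (f t) s)
  back? t = below? (f t)

  IsCut : Carrier → Carrier → Set
  IsCut t = Selects (f t) xs (k ℕ.+ k)

  FrontBelowBack BackBelowFront : Pred Carrier c
  FrontBelowBack t = ∃[ s ] IsCut t s × Crossed (g t) xs (front? t s) k (back? t s) h
  BackBelowFront t = ∃[ s ] IsCut t s × Crossed (g t) xs (back? t s) h (front? t s) k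

  Bisected : Pred Carrier c
  Bisected t = ∃[ s ] ∃[ u ] Balanced (g t) xs (front? t s) k u × Balanced (g t) xs (back? t s) h u

  -- More than 2k points lie on the cut or in front of it. The extra one pays for the `suc` in the
  -- bound on the length.
  back-size : ∀ {t s} → IsCut t s → # (back? t s) xs ℕ.≤ h ℕ.+ h
  back-size {t} {s} (_ , 2k<#≥) = ℕ.s≤s⁻¹ (ℕ.+-cancelˡ-≤ (k ℕ.+ k) _ _ (begin
    (k ℕ.+ k) ℕ.+ suc #back                ≡⟨ ℕ.+-suc (k ℕ.+ k) #back ⟩
    suc (k ℕ.+ k) ℕ.+ #back                ≤⟨ ℕ.+-monoˡ-≤ #back 2k<#≥ ⟩
    # (notBelow? (f t) s) xs ℕ.+ #back     ≤⟨ #-disjoint-length (notBelow? (f t) s) (back? t s) xs (λ s≤x → s≤x) ⟩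
    length xs                              ≤⟨ n≤2k+1+2h ⟩
    (k ℕ.+ k) ℕ.+ suc (h ℕ.+ h)            ∎))
    where
    open ℕ.≤-Reasoning
    #back = # (back? t s) xs

  cases : ∀ t → FrontBelowBack t ⊎ BackBelowFront t ⊎ Bisected t
  cases t with select (f t) xs 2k<n
  ... | s , cut with common-bisector (g t) xs (front? t s) (back? t s) (proj₁ cut) (back-size cut)
  ...   | inj₁ crossed             = inj₁ (s , cut , crossed)
  ...   | inj₂ (inj₁ crossed)      = inj₂ (inj₁ (s , cut , crossed))
  ...   | inj₂ (inj₂ (u , balanced)) = inj₂ (inj₂ (s , u , balanced))

  -- Whichever of the two crossing levels u, v is larger, one of the sides
  -- contains too many points.
  exclusive : ∀ t → FrontBelowBack t → ¬ BackBelowFront t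
  exclusive t (s , cut , u , k<#front<u , h<#back>u) (s′ , cut′ , v , h<#back<v , k<#front>v) = impossible
    where
    full : ∀ {p q r} {P : Pred A p} {Q : Pred A q} {D : Pred A r}
           (P? : Decidable P) (Q? : Decidable Q) (D? : Decidable D) {m : ℕ} →
           (∀ {x} → P x → D x) → (∀ {x} → Q x → D x) → (∀ {x} → P x → ¬ Q x) →
           m ℕ.< # P? xs → m ℕ.< # Q? xs → ¬ (# D? xs ℕ.≤ m ℕ.+ m)
    full P? Q? D? P⊆D Q⊆D P⊥Q m<#P m<#Q #D≤2m = ℕ.<-irrefl ≡.refl (ℕ.<-≤-trans
      (ℕ.<-≤-trans (ℕ.+-mono-< m<#P m<#Q) (#-disjoint P? Q? D? xs P⊆D Q⊆D P⊥Q)) #D≤2m)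
    -- The two alternatives come with cuts of their own. Both fronts lie in the front of the lower
    -- cut and both backs in the back of the upper one, so equality of the cuts need not be shown.
    lower-cut : ∃[ r ] IsCut t r × r ≤ s × r ≤ s′
    lower-cut with s <? s′
    ... | yes s<s′ = s , cut , irrefl refl , <⇒≤ s<s′
    ... | no  s′≤s = s′ , cut′ , s′≤s , irrefl refl
    upper-cut : ∃[ r ] IsCut t r × s ≤ r × s′ ≤ r
    upper-cut with s <? s′
    ... | yes s<s′ = s′ , cut′ , <⇒≤ s<s′ , irrefl refl
    ... | no  s′≤s = s , cut , irrefl refl , s′≤s
    impossible : _
    impossible with lower-cut | upper-cut | v <? u
    ... | r , (#front≤2k , _) , r≤s , r≤s′ | _ | no u≤v =
      full (front? t s ∩? below? (g t) u) (front? t s′ ∩? above? (g t) v) (front? t r)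
        (λ (s<x , _) → ≤-<-trans r≤s s<x) (λ (s′<x , _) → ≤-<-trans r≤s′ s′<x)
        (λ (_ , x<u) (_ , v<x) → u≤v (<-trans v<x x<u))
        k<#front<u k<#front>v #front≤2k
    ... | _ | r , cut-r , s≤r , s′≤r | yes v<u =
      full (back? t s ∩? above? (g t) u) (back? t s′ ∩? below? (g t) v) (back? t r)
        (λ (x<s , _) → <-≤-trans x<s s≤r) (λ (x<s′ , _) → <-≤-trans x<s′ s′≤r)
        (λ (_ , u<x) (_ , x<v) → irrefl refl (<-trans (<-trans v<u u<x) x<v))
        h<#back>u h<#back<v (back-size cut-r)

  -- Stability under small turns

  list-bound : (m : A → Carrier) (ys : List A) → ∃[ M ] 0# < M × (∀ {x} → x ∈ ys → Bounded M (m x))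
  list-bound m [] = 1# , 0<1 , λ ()
  list-bound m (y ∷ ys) with bound (m y) | list-bound m ys
  ... | M , 0<M , BM | N , 0<N , BN = M + N , 0<+ 0<M 0<N , λ where
    (here ≡.refl) → bounded-mono (<⇒≤ (<-by 0<N (solve 2 (λ M N → N := (M :+ N) :- M) refl M N))) BM
    (there x∈ys)  → bounded-mono (<⇒≤ (<-by 0<M (solve 2 (λ M N → M := (M :+ N) :- N) refl M N))) (BN x∈ys)

  -- Both coordinates are affine in `t`, with slopes Y - X and - X - Y that are bounded on a finite
  -- list.
  uniformly-continuous : ∀ {η} → 0# < η → ∃[ δ ] 0# < δ ×
    (∀ {t t′} → Bounded δ (t′ - t) → ∀ {x} → x ∈ xs →
      Bounded η (f t′ x - f t x) × Bounded η (g t′ x - g t x))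
  uniformly-continuous {η} 0<η =
    let M , 0<M , BM = list-bound (λ x → Y x - X x) xs
        N , 0<N , BN = list-bound (λ x → - X x - Y x) xs
        δ , 0<δ , _ , shrink-M = shrink 0<M 0<η
        ε , 0<ε , _ , shrink-N = shrink 0<N 0<η
        θ , 0<θ , θ≤δ , θ≤ε = common-slack 0<δ 0<ε
    in θ , 0<θ , λ {t} {t′} Bθ {x} x∈xs →
      bounded-resp (solve 4 (λ t t′ X Y → (t′ :- t) :* (Y :- X)
          := ((:1 :- t′) :* X :+ t′ :* Y) :- ((:1 :- t) :* X :+ t :* Y)) refl t t′ (X x) (Y x))
        (shrink-M (bounded-mono θ≤δ Bθ) (BM x∈xs)) ,
      bounded-resp (solve 4 (λ t t′ X Y → (t′ :- t) :* (:- X :- Y)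
          := ((:1 :- t′) :* Y :- t′ :* X) :- ((:1 :- t) :* Y :- t :* X)) refl t t′ (X x) (Y x))
        (shrink-N (bounded-mono θ≤ε Bθ) (BN x∈xs))

  -- Applied twice, with the old and the new position exchanged, to show that the cut cannot move by
  -- `η` while all values move by less.
  shifted : ∀ {η s s′ x x′} → η ≤ s′ - s → s′ ≤ x′ → x′ - x < η → s < x
  shifted {η} {s} {s′} {x} {x′} η≤s′-s s′≤x′ x′-x<η = <-by (0<y-x η<x+η-s)
      (solve 3 (λ s x η → (x :+ η :- s) :- η := x :- s) refl s x η)
    where
    x′<x+η : x′ < x + η
    x′<x+η = <-by (0<y-x x′-x<η) (solve 3 (λ x x′ η → η :- (x′ :- x) := (x :+ η) :- x′) refl x x′ η)
    η<x+η-s : η < x + η - s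
    η<x+η-s = ≤-<-trans η≤s′-s (<-by (0<y-x (≤-<-trans s′≤x′ x′<x+η))
      (solve 4 (λ s s′ x η → (x :+ η) :- s′ := (x :+ η :- s) :- (s′ :- s)) refl s s′ x η))

  SidesKept : (t s u t′ s′ : Carrier) → Set _
  SidesKept t s u t′ s′ = ∀ {x} → x ∈ xs →
    (Above (f t) s x → Above (f t′) s′ x) × (Below (f t) s x → Below (f t′) s′ x) ×
    (Above (g t) u x → Above (g t′) u x) × (Below (g t) u x → Below (g t′) u x)

  -- The level `u` stays fixed, while the cut has to follow its rank. If it rose by `η`, the more
  -- than 2k points on or in front of the new cut would all have been strictly in front of the old
  -- one, which has at most 2k there; a fall is excluded in the same way.
  sides-stable : ∀ t s u → IsCut t s →
    ∃[ δ ] 0# < δ × (∀ t′ → Bounded δ (t′ - t) → ∃[ s′ ] IsCut t′ s′ × SidesKept t s u t′ s′)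
  sides-stable t s u (#above≤2k , 2k<#≥) =
    let ε , 0<ε , ε-gap = gap (f t) s xs
        θ , 0<θ , θ-gap = gap (g t) u xs
        η , 0<η , η≤ε , η≤θ = common-slack 0<ε 0<θ
        δ , 0<δ , close = uniformly-continuous 0<η
    in δ , 0<δ , λ t′ Bδ →
      let s′ , #above′≤2k , 2k<#≥′ = select (f t′) xs 2k<n
          f-close : ∀ {x} → x ∈ xs → Bounded η (f t′ x - f t x)
          f-close x∈xs = proj₁ (close Bδ x∈xs)
          g-close : ∀ {x} → x ∈ xs → Bounded η (g t′ x - g t x)
          g-close x∈xs = proj₂ (close Bδ x∈xs)
          s′-close : Bounded η (s′ - s)
          s′-close =
            ≰⇒> (λ η≤s′-s → ℕ.<-irrefl ≡.refl (ℕ.<-≤-trans 2k<#≥′ (ℕ.≤-trans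
              (#-mono (notBelow? (f t′) s′) (above? (f t) s) xs λ x∈xs s′≤x →
                shifted η≤s′-s s′≤x (proj₁ (f-close x∈xs))) #above≤2k))) ,
            ≰⇒> (λ η≤s-s′ → ℕ.<-irrefl ≡.refl (ℕ.<-≤-trans 2k<#≥ (ℕ.≤-trans
              (#-mono (notBelow? (f t) s) (above? (f t′) s′) xs λ {x} x∈xs s≤x →
                shifted (≤-trans η≤s-s′ (≤-reflexive (solve 2 (λ s s′ → :- (s′ :- s) := s :- s′) refl s s′)))
                  s≤x (<-respˡ-≈ (solve 2 (λ x x′ → :- (x′ :- x) := x :- x′) refl (f t x) (f t′ x))
                    (proj₂ (f-close x∈xs)))) #above′≤2k)))
      in s′ , (#above′≤2k , 2k<#≥′) , λ {x} x∈xs →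
        (λ s<x → separated-stable (proj₂ (ε-gap η≤ε x∈xs) s<x) s′-close (f-close x∈xs)) ,
        (λ x<s → separated-stable (proj₁ (ε-gap η≤ε x∈xs) x<s) (f-close x∈xs) s′-close) ,
        (λ u<x → separated-stable (proj₂ (θ-gap η≤θ x∈xs) u<x) (bounded-0 0<η) (g-close x∈xs)) ,
        (λ x<u → separated-stable (proj₁ (θ-gap η≤θ x∈xs) x<u) (g-close x∈xs) (bounded-0 0<η))

  open-front-below : Open FrontBelowBack
  open-front-below t (s , cut , u , k<# , h<#) =
    let δ , 0<δ , stable = sides-stable t s u cut in
    δ , 0<δ , λ t′ Bδ → let s′ , cut′ , kept = stable t′ Bδ in
      s′ , cut′ , u ,
      ℕ.<-≤-trans k<# (#-mono (front? t s ∩? below? (g t) u) (front? t′ s′ ∩? below? (g t′) u) xs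
        (λ x∈xs (s<x , x<u) → let front , _ , _ , below = kept x∈xs in front s<x , below x<u)) ,
      ℕ.<-≤-trans h<# (#-mono (back? t s ∩? above? (g t) u) (back? t′ s′ ∩? above? (g t′) u) xs
        (λ x∈xs (x<s , u<x) → let _ , back , above , _ = kept x∈xs in back x<s , above u<x))

  open-back-below : Open BackBelowFront
  open-back-below t (s , cut , u , h<# , k<#) =
    let δ , 0<δ , stable = sides-stable t s u cut in
    δ , 0<δ , λ t′ Bδ → let s′ , cut′ , kept = stable t′ Bδ in
      s′ , cut′ , u ,
      ℕ.<-≤-trans h<# (#-mono (back? t s ∩? below? (g t) u) (back? t′ s′ ∩? below? (g t′) u) xs
        (λ x∈xs (x<s , x<u) → let _ , back , _ , below = kept x∈xs in back x<s , below x<u)) ,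
      ℕ.<-≤-trans k<# (#-mono (front? t s ∩? above? (g t) u) (front? t′ s′ ∩? above? (g t′) u) xs
        (λ x∈xs (s<x , u<x) → let front , _ , above , _ = kept x∈xs in front s<x , above u<x))

  -- Multisets are invariant only up to equality of reals, so invariance of counts can be asked only
  -- of predicates that see a point through its coordinates.
  Respects : ∀ {p} → Pred A p → Set _
  Respects P = ∀ {x y} → X x ≈ X y → Y x ≈ Y y → P x → P y

  -- The involution between the two ends of the turn

  module Mirror (R : A → A) (β γ b₁ b₂ : Carrier) (0<β : 0# < β) (0<γ : 0# < γ)
    (X∘R : ∀ x → X (R x) ≈ β * Y x + b₁) (Y∘R : ∀ x → Y (R x) ≈ γ * X x + b₂)
    (invariant : ∀ {P : Pred A ℓ₂} (P? : Decidable P) → Respects P → # (P? ∘ R) xs ≡ # P? xs)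
    where

    f₁∘R : ∀ x → f 1# (R x) ≈ γ * f 0# x + b₂
    f₁∘R x = trans (solve 2 (λ X Y → (:1 :- :1) :* X :+ :1 :* Y := Y) refl (X (R x)) (Y (R x)))
      (trans (Y∘R x) (+-congʳ (*-congˡ
        (solve 2 (λ X Y → X := (:1 :- :0) :* X :+ :0 :* Y) refl (X x) (Y x)))))

    -- The quarter turn takes `Y` to - X, whereas `X ∘ R` is an increasing function of `Y`. This
    -- sign reverses the order of the levels; `f` acquires none, so the front stays the front.
    g₁∘R : ∀ x → g 1# (R x) ≈ - (β * g 0# x + b₁)
    g₁∘R x = trans (solve 2 (λ X Y → (:1 :- :1) :* Y :- :1 :* X := :- X) refl (X (R x)) (Y (R x)))
      (-‿cong (trans (X∘R x) (+-congʳ (*-congˡ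
        (solve 2 (λ X Y → Y := (:1 :- :0) :* Y :- :0 :* X) refl (X x) (Y x))))))

    module _ (s u : Carrier) where
      s′ u′ : Carrier
      s′ = γ * s + b₂
      u′ = - (β * u + b₁)

      front⁺ : ∀ {x} → Above (f 0#) s x → Above (f 1#) s′ (R x)
      front⁺ {x} s<x = <-respʳ-≈ (sym (f₁∘R x)) (affine-mono b₂ 0<γ s<x)

      back⁺ : ∀ {x} → Below (f 0#) s x → Below (f 1#) s′ (R x)
      back⁺ {x} x<s = <-respˡ-≈ (sym (f₁∘R x)) (affine-mono b₂ 0<γ x<s)

      front⁻ : ∀ {x} → Above (f 1#) s′ (R x) → Above (f 0#) s x
      front⁻ {x} s′<Rx = affine-cancel b₂ 0<γ (<-respʳ-≈ (f₁∘R x) s′<Rx)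

      back⁻ : ∀ {x} → Below (f 1#) s′ (R x) → Below (f 0#) s x
      back⁻ {x} Rx<s′ = affine-cancel b₂ 0<γ (<-respˡ-≈ (f₁∘R x) Rx<s′)

      below⇒above : ∀ {x} → Below (g 0#) u x → Above (g 1#) u′ (R x)
      below⇒above {x} x<u = <-respʳ-≈ (sym (g₁∘R x)) (neg-mono (affine-mono b₁ 0<β x<u))

      above⇒below : ∀ {x} → Above (g 0#) u x → Below (g 1#) u′ (R x)
      above⇒below {x} u<x = <-respˡ-≈ (sym (g₁∘R x)) (neg-mono (affine-mono b₁ 0<β u<x))

    f-cong : ∀ {x y} → X x ≈ X y → Y x ≈ Y y → f 1# x ≈ f 1# y
    f-cong X≈ Y≈ = +-cong (*-congˡ X≈) (*-congˡ Y≈)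

    g-cong : ∀ {x y} → X x ≈ X y → Y x ≈ Y y → g 1# x ≈ g 1# y
    g-cong X≈ Y≈ = +-cong (*-congˡ Y≈) (-‿cong (*-congˡ X≈))

    mirror-cut : ∀ s → IsCut 0# s → IsCut 1# (γ * s + b₂)
    mirror-cut s (#above≤2k , 2k<#≥) =
      ℕ.≤-trans (ℕ.≤-reflexive (≡.sym (invariant (front? 1# s′′)
          (λ X≈ Y≈ → <-respʳ-≈ (f-cong X≈ Y≈)))))
        (ℕ.≤-trans (#-mono (front? 1# s′′ ∘ R) (front? 0# s) xs (λ _ → front⁻ s 0#)) #above≤2k) ,
      ℕ.<-≤-trans 2k<#≥ (ℕ.≤-trans
        (#-mono (notBelow? (f 0#) s) (notBelow? (f 1#) s′′ ∘ R) xs (λ _ s≤x → s≤x ∘ back⁻ s 0#))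
        (ℕ.≤-reflexive (invariant (notBelow? (f 1#) s′′)
          (λ X≈ Y≈ s≤x y<s → s≤x (<-respˡ-≈ (sym (f-cong X≈ Y≈)) y<s)))))
      where s′′ = γ * s + b₂

    mirror-front-below : FrontBelowBack 0# → BackBelowFront 1#
    mirror-front-below (s , cut , u , k<# , h<#) = s′ s u , mirror-cut s cut , u′ s u ,
      ℕ.<-≤-trans h<# (ℕ.≤-trans
        (#-mono (back? 0# s ∩? above? (g 0#) u) (B? ∘ R) xs
          (λ _ (x<s , u<x) → back⁺ s u x<s , above⇒below s u u<x))
        (ℕ.≤-reflexive (invariant B? λ X≈ Y≈ (p , q) →
          <-respˡ-≈ (f-cong X≈ Y≈) p , <-respˡ-≈ (g-cong X≈ Y≈) q))) ,
      ℕ.<-≤-trans k<# (ℕ.≤-trans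
        (#-mono (front? 0# s ∩? below? (g 0#) u) (F? ∘ R) xs
          (λ _ (s<x , x<u) → front⁺ s u s<x , below⇒above s u x<u))
        (ℕ.≤-reflexive (invariant F? λ X≈ Y≈ (p , q) →
          <-respʳ-≈ (f-cong X≈ Y≈) p , <-respʳ-≈ (g-cong X≈ Y≈) q)))
      where
      B? = back? 1# (s′ s u) ∩? below? (g 1#) (u′ s u)
      F? = front? 1# (s′ s u) ∩? above? (g 1#) (u′ s u)

    mirror-back-below : BackBelowFront 0# → FrontBelowBack 1#
    mirror-back-below (s , cut , u , h<# , k<#) = s′ s u , mirror-cut s cut , u′ s u ,
      ℕ.<-≤-trans k<# (ℕ.≤-trans
        (#-mono (front? 0# s ∩? above? (g 0#) u) (F? ∘ R) xs
          (λ _ (s<x , u<x) → front⁺ s u s<x , above⇒below s u u<x))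
        (ℕ.≤-reflexive (invariant F? λ X≈ Y≈ (p , q) →
          <-respʳ-≈ (f-cong X≈ Y≈) p , <-respˡ-≈ (g-cong X≈ Y≈) q))) ,
      ℕ.<-≤-trans h<# (ℕ.≤-trans
        (#-mono (back? 0# s ∩? below? (g 0#) u) (B? ∘ R) xs
          (λ _ (x<s , x<u) → back⁺ s u x<s , below⇒above s u x<u))
        (ℕ.≤-reflexive (invariant B? λ X≈ Y≈ (p , q) →
          <-respˡ-≈ (f-cong X≈ Y≈) p , <-respʳ-≈ (g-cong X≈ Y≈) q)))
      where
      B? = back? 1# (s′ s u) ∩? above? (g 1#) (u′ s u)
      F? = front? 1# (s′ s u) ∩? below? (g 1#) (u′ s u)

    bisected : ∃ Bisected
    bisected with cases 0#
    ... | inj₂ (inj₂ solved) = 0# , solved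
    ... | inj₁ front-below = connected {S = Bisected}
      (open-lift open-front-below) open-back-below (λ t → exclusive t ∘ lower)
      (lift front-below) (mirror-front-below front-below) (λ t → map₁ lift (cases t))
    ... | inj₂ (inj₁ back-below) = connected {S = Bisected}
      (open-lift open-back-below) open-front-below (λ t d i → exclusive t i (lower d))
      (lift back-below) (mirror-back-below back-below)
      (λ t → [ inj₂ ∘ inj₁ , [ inj₁ ∘ lift , inj₂ ∘ inj₂ ]′ ]′ (cases t))

-- Axes exchanged by an involution

module Quadratic {c ℓ₁ ℓ₂} (ℝ : CompleteOrderedField c ℓ₁ ℓ₂) where
  open CompleteOrderedField ℝ hiding (zero)
  open OrderedField ℝ

  -- The binary quadratic form A x² + B x y + C y² at (1 - t , t).
  form : (A B C t : Carrier) → Carrier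
  form A B C t = (1# - t) * (1# - t) * A + (1# - t) * t * B + t * t * C

  -- The increment is t′ - t times B - 2A + 2Ft + F(t′ - t), where `F` is the coefficient of t². The
  -- last summand is bounded because `δ ≤ 1`.
  form-continuous : ∀ A B C t {η} → 0# < η → ∃[ δ ] 0# < δ ×
    (∀ t′ → Bounded δ (t′ - t) → Bounded η (form A B C t′ - form A B C t))
  form-continuous A B C t 0<η =
    let M , 0<M , BM = bound (B - (A + A) + (F + F) * t)
        N , 0<N , BN = bound F
        δ , 0<δ , δ≤1 , small = shrink (0<+ 0<M (0<* 0<N 0<1)) 0<η
    in δ , 0<δ , λ t′ Bδ → bounded-resp
      (solve 5 (λ A B C t t′ → let F = A :- B :+ C in
          (t′ :- t) :* ((B :- (A :+ A) :+ (F :+ F) :* t) :+ F :* (t′ :- t))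
          := ((:1 :- t′) :* (:1 :- t′) :* A :+ (:1 :- t′) :* t′ :* B :+ t′ :* t′ :* C)
             :- ((:1 :- t) :* (:1 :- t) :* A :+ (:1 :- t) :* t :* B :+ t :* t :* C)) refl A B C t t′)
      (small Bδ (bounded-+ BM (bounded-* BN (bounded-mono δ≤1 Bδ))))
    where
    F = A - B + C

  form-0 : ∀ A B C → form A B C 0# ≈ A
  form-0 = solve 3 (λ A B C → (:1 :- :0) :* (:1 :- :0) :* A :+ (:1 :- :0) :* :0 :* B :+ :0 :* :0 :* C := A) refl

  form-1 : ∀ A B C → form A B C 1# ≈ C
  form-1 = solve 3 (λ A B C → (:1 :- :1) :* (:1 :- :1) :* A :+ (:1 :- :1) :* :1 :* B :+ :1 :* :1 :* C := C) refl

  form-neg : ∀ A B C t → form A B C t ≈ 0# - form (- A) (- B) (- C) t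
  form-neg = solve 4 (λ A B C t →
    (:1 :- t) :* (:1 :- t) :* A :+ (:1 :- t) :* t :* B :+ t :* t :* C
    := :0 :- ((:1 :- t) :* (:1 :- t) :* (:- A) :+ (:1 :- t) :* t :* (:- B) :+ t :* t :* (:- C))) refl

  -- The intermediate value theorem for `form`, obtained from `connected` with the sets of negative
  -- and of positive values.
  form-root-<> : ∀ A B C → A < 0# → 0# < C → ∃[ t ] form A B C t ≈ 0#
  form-root-<> A B C A<0 0<C = connected {S = λ t → q t ≈ 0#} (open-lift open-neg) open-pos
    (λ t (lift q<0) 0<q → irrefl refl (<-trans q<0 0<q))
    (lift (<-respˡ-≈ (sym (form-0 A B C)) A<0)) (<-respʳ-≈ (sym (form-1 A B C)) 0<C)
    λ t → sign t
    where
    q = form A B C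
    open-neg : Open (λ t → q t < 0#)
    open-neg t q<0 =
      let δ , 0<δ , close = form-continuous A B C t (0<y-x q<0) in
      δ , 0<δ , λ t′ Bδ → <-by (0<y-x (proj₁ (close t′ Bδ)))
        (solve 2 (λ q q′ → (:0 :- q) :- (q′ :- q) := :0 :- q′) refl (q t) (q t′))
    open-pos : Open (λ t → 0# < q t)
    open-pos t 0<q =
      let δ , 0<δ , close = form-continuous A B C t 0<q in
      δ , 0<δ , λ t′ Bδ → <-by (0<y-x (proj₂ (close t′ Bδ)))
        (solve 2 (λ q q′ → q :- (:- (q′ :- q)) := q′ :- :0) refl (q t) (q t′))
    sign : ∀ t → _
    sign t with compare (q t) 0#
    ... | tri< q<0 _ _ = inj₁ (lift q<0)
    ... | tri≈ _ q≈0 _ = inj₂ (inj₂ q≈0)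
    ... | tri> _ _ 0<q = inj₂ (inj₁ 0<q)

  -- `A` and `C` are the values at 0 and 1, so they vanish together or have opposite signs. Negating
  -- the form exchanges the two sign patterns.
  form-root : ∀ A B C → A + C ≈ 0# → ∃[ t ] form A B C t ≈ 0#
  form-root A B C A+C≈0 with compare A 0#
  ... | tri≈ _ A≈0 _ = 0# , trans (form-0 A B C) A≈0
  ... | tri< A<0 _ _ = form-root-<> A B C A<0 (<-by (0<y-x A<0)
          (trans (solve 2 (λ A C → :0 :- A := C :- (A :+ C)) refl A C) (+-congˡ (-‿cong A+C≈0))))
  ... | tri> _ _ 0<A =
    map₂ form-neg-root (form-root-<> (- A) (- B) (- C)
          (<-by 0<A (solve 1 (λ A → A := :0 :- (:- A)) refl A))
          (<-by 0<A (trans (solve 2 (λ A C → A := (A :+ C) :+ (:- C :- :0)) refl A C)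
            (trans (+-congʳ A+C≈0) (+-identityˡ _)))))
    where
    form-neg-root : ∀ {t} → form (- A) (- B) (- C) t ≈ 0# → form A B C t ≈ 0#
    form-neg-root {t} root = trans (form-neg A B C t) (trans (+-congˡ (-‿cong root)) (-‿inverseʳ 0#))

module AxisSwap {c ℓ₁ ℓ₂} (ℝ : CompleteOrderedField c ℓ₁ ℓ₂) where
  open CompleteOrderedField ℝ hiding (zero)
  open OrderedField ℝ
  open Quadratic ℝ
  open Plane ℝ

  module _ (R : AffineMap) (involution : Involution R) (reversing : OrientationReversing R) where
    open AffineMap R using (l₁₁; l₁₂; l₂₁; l₂₂; b₁; b₂)

    -- The entries of L² = 1 come from R ∘ R = id at a unit vector minus the same at the origin,
    -- which cancels the translation.
    square₁₁ : l₁₁ * l₁₁ + l₁₂ * l₂₁ ≈ 1#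
    square₁₁ = trans
      (solve 6 (λ a b c d u v → a :* a :+ b :* c
        := (a :* (a :* :1 :+ b :* :0 :+ u) :+ b :* (c :* :1 :+ d :* :0 :+ v) :+ u)
        :- (a :* (a :* :0 :+ b :* :0 :+ u) :+ b :* (c :* :0 :+ d :* :0 :+ v) :+ u)) refl l₁₁ l₁₂ l₂₁ l₂₂ b₁ b₂)
      (trans (minus-cong (proj₁ (involution (1# , 0#))) (proj₁ (involution (0# , 0#))))
        (solve 0 (:1 :- :0 := :1) refl))

    square₂₁ : l₂₁ * l₁₁ + l₂₂ * l₂₁ ≈ 0#
    square₂₁ = trans
      (solve 6 (λ a b c d u v → c :* a :+ d :* c
        := (c :* (a :* :1 :+ b :* :0 :+ u) :+ d :* (c :* :1 :+ d :* :0 :+ v) :+ v)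
        :- (c :* (a :* :0 :+ b :* :0 :+ u) :+ d :* (c :* :0 :+ d :* :0 :+ v) :+ v)) refl l₁₁ l₁₂ l₂₁ l₂₂ b₁ b₂)
      (trans (minus-cong (proj₂ (involution (1# , 0#))) (proj₂ (involution (0# , 0#))))
        (-‿inverseʳ 0#))

    square₁₂ : l₁₁ * l₁₂ + l₁₂ * l₂₂ ≈ 0#
    square₁₂ = trans
      (solve 6 (λ a b c d u v → a :* b :+ b :* d
        := (a :* (a :* :0 :+ b :* :1 :+ u) :+ b :* (c :* :0 :+ d :* :1 :+ v) :+ u)
        :- (a :* (a :* :0 :+ b :* :0 :+ u) :+ b :* (c :* :0 :+ d :* :0 :+ v) :+ u)) refl l₁₁ l₁₂ l₂₁ l₂₂ b₁ b₂)
      (trans (minus-cong (proj₁ (involution (0# , 1#))) (proj₁ (involution (0# , 0#))))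
        (-‿inverseʳ 0#))

    square₂₂ : l₂₁ * l₁₂ + l₂₂ * l₂₂ ≈ 1#
    square₂₂ = trans
      (solve 6 (λ a b c d u v → c :* b :+ d :* d
        := (c :* (a :* :0 :+ b :* :1 :+ u) :+ d :* (c :* :0 :+ d :* :1 :+ v) :+ v)
        :- (c :* (a :* :0 :+ b :* :0 :+ u) :+ d :* (c :* :0 :+ d :* :0 :+ v) :+ v)) refl l₁₁ l₁₂ l₂₁ l₂₂ b₁ b₂)
      (trans (minus-cong (proj₂ (involution (0# , 1#))) (proj₂ (involution (0# , 0#))))
        (solve 0 (:1 :- :0 := :1) refl))

    trace : Carrier
    trace = l₁₁ + l₂₂

    -- L² = 1 gives (tr L) l₁₂ = (tr L) l₂₁ = 0 and (tr L) l₁₁ = (tr L) l₂₂,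
    -- hence (tr L)² det L = ((tr L) l₁₁)², which is nonnegative.
    trace≈0 : trace ≈ 0#
    trace≈0 with trace ≟ 0#
    ... | yes trace≈0 = trace≈0
    ... | no  trace≉0 = contradiction
      (<-by (0<* (0<x² trace≉0) (0<y-x reversing)) (begin
        trace * trace * (0# - det R)
          ≈⟨ solve 4 (λ a b c d → let T = a :+ d in
               T :* T :* (:0 :- (a :* d :- b :* c))
               := (a :* b :+ b :* d) :* (c :* a :+ d :* c)
                  :+ (T :* a) :* ((a :* a :+ b :* c) :- (c :* b :+ d :* d))
                  :+ (:0 :- (T :* a) :* (T :* a))) refl l₁₁ l₁₂ l₂₁ l₂₂ ⟩
        (l₁₁ * l₁₂ + l₁₂ * l₂₂) * (l₂₁ * l₁₁ + l₂₂ * l₂₁)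
          + trace * l₁₁ * ((l₁₁ * l₁₁ + l₁₂ * l₂₁) - (l₂₁ * l₁₂ + l₂₂ * l₂₂))
          + (0# - trace * l₁₁ * (trace * l₁₁))
          ≈⟨ +-congʳ (+-cong (*-cong square₁₂ square₂₁) (*-congˡ (minus-cong square₁₁ square₂₂))) ⟩
        0# * 0# + trace * l₁₁ * (1# - 1#) + (0# - trace * l₁₁ * (trace * l₁₁))
          ≈⟨ solve 1 (λ x → :0 :* :0 :+ x :* (:1 :- :1) :+ (:0 :- x :* x) := :0 :- x :* x) refl (trace * l₁₁) ⟩
        0# - trace * l₁₁ * (trace * l₁₁) ∎))
      (0≤x² (trace * l₁₁))
      where open import Relation.Binary.Reasoning.Setoid setoid

    -- wᵀ L w, wᵀ L w′ and w′ᵀ L w for w = (α , β) and w′ = (- β , α).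
    diagonal forth back : (α β : Carrier) → Carrier
    diagonal α β = (α * l₁₁ + β * l₂₁) * α + (α * l₁₂ + β * l₂₂) * β
    forth    α β = (α * l₁₁ + β * l₂₁) * (- β) + (α * l₁₂ + β * l₂₂) * α
    back     α β = ((- β) * l₁₁ + α * l₂₁) * α + ((- β) * l₁₂ + α * l₂₂) * β

    -- In the orthogonal basis w, w′ of vectors of equal length, the two diagonal values of the form
    -- add up to tr L times |w|².
    rotated-diagonal : ∀ α β → diagonal (- β) α ≈ trace * (α * α + β * β) - diagonal α β
    rotated-diagonal = solve 6 (λ a b c d α β →
      ((:- β) :* a :+ α :* c) :* (:- β) :+ ((:- β) :* b :+ α :* d) :* α
      := (a :+ d) :* (α :* α :+ β :* β) :- ((α :* a :+ β :* c) :* α :+ (α :* b :+ β :* d) :* β))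
      refl l₁₁ l₁₂ l₂₁ l₂₂

    rotated-diagonal≈0 : ∀ {α β} → diagonal α β ≈ 0# → diagonal (- β) α ≈ 0#
    rotated-diagonal≈0 {α} {β} diagonal≈0 = trans (rotated-diagonal α β)
      (trans (minus-cong (trans (*-congʳ trace≈0) (zeroˡ _)) diagonal≈0) (-‿inverseʳ 0#))

    -- With trace 0, the matrix of L in the basis w, w′ is antidiagonal with positive entries: L
    -- exchanges the axes together with their directions.
    SwapsAxes : (α β : Carrier) → Set _
    SwapsAxes α β = ¬ (α ≈ 0# × β ≈ 0#) × diagonal α β ≈ 0# × 0# < forth α β × 0# < back α β

    -- The determinant of the form in the basis w, w′ is det L times the squared determinant |w|⁴ of
    -- the base change; its diagonal product vanishes.
    forth*back : ∀ {α β} → diagonal α β ≈ 0# →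
      (0# - det R) * ((α * α + β * β) * (α * α + β * β)) ≈ forth α β * back α β
    forth*back {α} {β} diagonal≈0 = trans
      (solve 6 (λ a b c d α β → let N = α :* α :+ β :* β in
        (:0 :- (a :* d :- b :* c)) :* (N :* N)
        := (((α :* a :+ β :* c) :* (:- β) :+ (α :* b :+ β :* d) :* α)
            :* (((:- β) :* a :+ α :* c) :* α :+ ((:- β) :* b :+ α :* d) :* β))
          :- ((α :* a :+ β :* c) :* α :+ (α :* b :+ β :* d) :* β)
             :* (((:- β) :* a :+ α :* c) :* (:- β) :+ ((:- β) :* b :+ α :* d) :* α))
        refl l₁₁ l₁₂ l₂₁ l₂₂ α β)
      (trans (+-congˡ (-‿cong (trans (*-congʳ diagonal≈0) (zeroˡ _))))
        (solve 1 (λ x → x :- :0 := x) refl _))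

    swaps-axes : ∀ {α β} → ¬ (α ≈ 0# × β ≈ 0#) → diagonal α β ≈ 0# → ∃[ α ] ∃[ β ] SwapsAxes α β
    swaps-axes {α} {β} α,β≉0 diagonal≈0 = choose
      where
      0<forth*back : 0# < forth α β * back α β
      0<forth*back = <-respʳ-≈ (forth*back diagonal≈0)
        (0<* (0<y-x reversing) (0<* (0<x²+y² α,β≉0) (0<x²+y² α,β≉0)))

      choose : ∃[ α ] ∃[ β ] SwapsAxes α β
      choose with compare 0# (forth α β)
      ... | tri< 0<forth _ _ =
        α , β , α,β≉0 , diagonal≈0 , 0<forth , 0<*-cancelˡ 0<forth 0<forth*back
      ... | tri≈ _ 0≈forth _ = contradiction 0<forth*back
        (irrefl (trans (sym (zeroˡ _)) (*-congʳ 0≈forth)))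
      -- Passing from w to w′ replaces `forth` and `back` by `- back` and `- forth`, both positive
      -- here.
      ... | tri> _ _ forth<0 = - β , α ,
        (λ (-β≈0 , α≈0) → α,β≉0 (α≈0 ,
          trans (solve 1 (λ β → β := :0 :- (:- β)) refl β) (trans (+-congˡ (-‿cong -β≈0)) (-‿inverseʳ 0#)))) ,
        rotated-diagonal≈0 diagonal≈0 ,
        <-respʳ-≈
          (solve 6 (λ a b c d α β →
            :- (((:- β) :* a :+ α :* c) :* α :+ ((:- β) :* b :+ α :* d) :* β)
            := ((:- β) :* a :+ α :* c) :* (:- α) :+ ((:- β) :* b :+ α :* d) :* (:- β)) refl l₁₁ l₁₂ l₂₁ l₂₂ α β)
          0<-back ,
        <-respʳ-≈
          (solve 6 (λ a b c d α β →
            :- ((α :* a :+ β :* c) :* (:- β) :+ (α :* b :+ β :* d) :* α)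
            := ((:- α) :* a :+ (:- β) :* c) :* (:- β) :+ ((:- α) :* b :+ (:- β) :* d) :* α) refl l₁₁ l₁₂ l₂₁ l₂₂ α β)
          (0<-x forth<0)
        where
        0<-back : 0# < - back α β
        0<-back = 0<*-cancelˡ (0<-x forth<0) (<-respʳ-≈
          (solve 2 (λ x y → x :* y := (:- x) :* (:- y)) refl (forth α β) (back α β)) 0<forth*back)

    swapped-axes : ∃[ α ] ∃[ β ] SwapsAxes α β
    swapped-axes = from-root (form-root l₁₁ (l₁₂ + l₂₁) l₂₂ trace≈0)
      where
      diagonal-form : ∀ t → diagonal (1# - t) t ≈ form l₁₁ (l₁₂ + l₂₁) l₂₂ t
      diagonal-form = solve 5 (λ a b c d t →
        ((:1 :- t) :* a :+ t :* c) :* (:1 :- t) :+ ((:1 :- t) :* b :+ t :* d) :* t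
        := (:1 :- t) :* (:1 :- t) :* a :+ (:1 :- t) :* t :* (b :+ c) :+ t :* t :* d)
        refl l₁₁ l₁₂ l₂₁ l₂₂

      from-root : ∃[ t ] form l₁₁ (l₁₂ + l₂₁) l₂₂ t ≈ 0# → ∃[ α ] ∃[ β ] SwapsAxes α β
      from-root (t , root) = swaps-axes (1-t,t≉0 t) (trans (diagonal-form t) root)

    module Coordinates {α β : Carrier} (swaps : SwapsAxes α β) {N⁻¹ : Carrier} (0<N⁻¹ : 0# < N⁻¹)
      (N*N⁻¹≈1 : (α * α + β * β) * N⁻¹ ≈ 1#) where
      X Y : Point → Carrier
      X (x , y) = α * x + β * y
      Y (x , y) = - β * x + α * y

      γ δ e₁ e₂ : Carrier
      γ  = forth α β * N⁻¹
      δ  = back α β * N⁻¹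
      e₁ = α * b₁ + β * b₂
      e₂ = - β * b₁ + α * b₂

      0<γ : 0# < γ
      0<γ = 0<* (proj₁ (proj₂ (proj₂ swaps))) 0<N⁻¹

      0<δ : 0# < δ
      0<δ = 0<* (proj₂ (proj₂ (proj₂ swaps))) 0<N⁻¹

      divide-N : ∀ u → u ≈ N⁻¹ * ((α * α + β * β) * u)
      divide-N u = sym (trans
        (solve 3 (λ r n u → r :* (n :* u) := (n :* r) :* u) refl N⁻¹ (α * α + β * β) u)
        (trans (*-congʳ N*N⁻¹≈1) (*-identityˡ u)))

      -- Expand |w|² p = (w · p) w + (w′ · p) w′ and apply wᵀ L: the term with wᵀ L w drops out.
      -- Dividing by |w|² avoids normalising w by a square root.
      X∘R : ∀ p → X (apply R p) ≈ γ * Y p + e₁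
      X∘R (x , y) = begin
        α * (l₁₁ * x + l₁₂ * y + b₁) + β * (l₂₁ * x + l₂₂ * y + b₂)
          ≈⟨ solve 10 (λ a b c d u v α β x y →
               α :* (a :* x :+ b :* y :+ u) :+ β :* (c :* x :+ d :* y :+ v)
               := (α :* (a :* x :+ b :* y) :+ β :* (c :* x :+ d :* y)) :+ (α :* u :+ β :* v))
             refl l₁₁ l₁₂ l₂₁ l₂₂ b₁ b₂ α β x y ⟩
        (α * (l₁₁ * x + l₁₂ * y) + β * (l₂₁ * x + l₂₂ * y)) + e₁
          ≈⟨ +-congʳ (divide-N _) ⟩
        N⁻¹ * ((α * α + β * β) * (α * (l₁₁ * x + l₁₂ * y) + β * (l₂₁ * x + l₂₂ * y))) + e₁
          ≈⟨ +-congʳ (solve 9 (λ a b c d α β x y r →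
               r :* ((α :* α :+ β :* β) :* (α :* (a :* x :+ b :* y) :+ β :* (c :* x :+ d :* y)))
               := (((α :* a :+ β :* c) :* (:- β) :+ (α :* b :+ β :* d) :* α) :* r) :* ((:- β) :* x :+ α :* y)
                  :+ ((α :* a :+ β :* c) :* α :+ (α :* b :+ β :* d) :* β) :* (r :* (α :* x :+ β :* y)))
             refl l₁₁ l₁₂ l₂₁ l₂₂ α β x y N⁻¹) ⟩
        (γ * Y (x , y) + diagonal α β * (N⁻¹ * X (x , y))) + e₁
          ≈⟨ +-congʳ (trans (+-congˡ (trans (*-congʳ (proj₁ (proj₂ swaps))) (zeroˡ _))) (+-identityʳ _)) ⟩
        γ * Y (x , y) + e₁ ∎
        where open import Relation.Binary.Reasoning.Setoid setoid

      Y∘R : ∀ p → Y (apply R p) ≈ δ * X p + e₂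
      Y∘R (x , y) = begin
        - β * (l₁₁ * x + l₁₂ * y + b₁) + α * (l₂₁ * x + l₂₂ * y + b₂)
          ≈⟨ solve 10 (λ a b c d u v α β x y →
               (:- β) :* (a :* x :+ b :* y :+ u) :+ α :* (c :* x :+ d :* y :+ v)
               := ((:- β) :* (a :* x :+ b :* y) :+ α :* (c :* x :+ d :* y)) :+ ((:- β) :* u :+ α :* v))
             refl l₁₁ l₁₂ l₂₁ l₂₂ b₁ b₂ α β x y ⟩
        (- β * (l₁₁ * x + l₁₂ * y) + α * (l₂₁ * x + l₂₂ * y)) + e₂
          ≈⟨ +-congʳ (divide-N _) ⟩
        N⁻¹ * ((α * α + β * β) * (- β * (l₁₁ * x + l₁₂ * y) + α * (l₂₁ * x + l₂₂ * y))) + e₂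
          ≈⟨ +-congʳ (solve 9 (λ a b c d α β x y r →
               r :* ((α :* α :+ β :* β) :* ((:- β) :* (a :* x :+ b :* y) :+ α :* (c :* x :+ d :* y)))
               := ((((:- β) :* a :+ α :* c) :* α :+ ((:- β) :* b :+ α :* d) :* β) :* r) :* (α :* x :+ β :* y)
                  :+ (((:- β) :* a :+ α :* c) :* (:- β) :+ ((:- β) :* b :+ α :* d) :* α)
                     :* (r :* ((:- β) :* x :+ α :* y)))
             refl l₁₁ l₁₂ l₂₁ l₂₂ α β x y N⁻¹) ⟩
        (δ * X (x , y) + diagonal (- β) α * (N⁻¹ * Y (x , y))) + e₂
          ≈⟨ +-congʳ (trans (+-congˡ (trans (*-congʳ (rotated-diagonal≈0 (proj₁ (proj₂ swaps)))) (zeroˡ _)))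
               (+-identityʳ _)) ⟩
        δ * X (x , y) + e₂ ∎
        where open import Relation.Binary.Reasoning.Setoid setoid

      X-cong : ∀ {p q} → p ≈ₚ q → X p ≈ X q
      X-cong (x≈ , y≈) = +-cong (*-congˡ x≈) (*-congˡ y≈)

      Y-cong : ∀ {p q} → p ≈ₚ q → Y p ≈ Y q
      Y-cong (x≈ , y≈) = +-cong (*-congˡ x≈) (*-congˡ y≈)

-- The two lines

open import Data.Nat.Base using (_≤_; _*_; _∸_)

-- Strictness, needed for a value of rank 2k to exist, comes from 2k < 4k if `k` is positive and
-- from `0 < n` otherwise.
k≤n/4⇒k+k<n : ∀ {k n} → k ≤ n / 4 → 0 ℕ.< n → k ℕ.+ k ℕ.< n
k≤n/4⇒k+k<n {zero}      k≤n/4 0<n = 0<n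
k≤n/4⇒k+k<n {k@(suc _)} {n} k≤n/4 0<n = begin-strict
  k ℕ.+ k                  <⟨ ℕ.m<m+n (k ℕ.+ k) (s≤s z≤n) ⟩
  (k ℕ.+ k) ℕ.+ (k ℕ.+ k)  ≡⟨ quadruple k ⟨
  k * 4                    ≤⟨ ℕ.*-monoˡ-≤ 4 k≤n/4 ⟩
  n / 4 * 4                ≤⟨ m/n*n≤m n 4 ⟩
  n                        ∎
  where
  open ℕ.≤-Reasoning
  quadruple : ∀ k → k * 4 ≡ (k ℕ.+ k) ℕ.+ (k ℕ.+ k)
  quadruple = solve-∀

-- The `suc` absorbs the remainder of n - 2k modulo 2.
n≤2k+1+2h : ∀ k n → n ≤ (k ℕ.+ k) ℕ.+ suc ((n ∸ 2 * k) / 2 ℕ.+ (n ∸ 2 * k) / 2)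
n≤2k+1+2h k n = begin
  n                                    ≤⟨ ℕ.m≤n+m∸n n (2 * k) ⟩
  2 * k ℕ.+ m                          ≡⟨ ≡.cong₂ ℕ._+_ (double k) (m≡m%n+[m/n]*n m 2) ⟩
  (k ℕ.+ k) ℕ.+ (m % 2 ℕ.+ m / 2 * 2)  ≤⟨ ℕ.+-monoʳ-≤ (k ℕ.+ k) (ℕ.+-monoˡ-≤ (m / 2 * 2) (ℕ.s≤s⁻¹ (m%n<n m 2))) ⟩
  (k ℕ.+ k) ℕ.+ suc (m / 2 * 2)        ≡⟨ ≡.cong (λ x → (k ℕ.+ k) ℕ.+ suc x) (≡.trans (ℕ.*-comm (m / 2) 2) (double (m / 2))) ⟩
  (k ℕ.+ k) ℕ.+ suc (m / 2 ℕ.+ m / 2)  ∎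
  where
  open ℕ.≤-Reasoning
  m = n ∸ 2 * k
  double : ∀ x → 2 * x ≡ x ℕ.+ x
  double = solve-∀

module PerpendicularLines {c ℓ₁ ℓ₂} (ℝ : CompleteOrderedField c ℓ₁ ℓ₂) where
  open CompleteOrderedField ℝ hiding (zero; _≤_) renaming (_*_ to _·_)
  open OrderedField ℝ
  open OrderStatistics ℝ
  open AxisSwap ℝ
  open Plane ℝ

  -- The turned axes (1 - t) w + t w′ and (1 - t) w′ - t w for w = (α , β), w′ = (- β , α).
  module TurnedLines (α β t : Carrier) (α,β≉0 : ¬ (α ≈ 0# × β ≈ 0#)) where

    -- The turn is multiplication by a complex number with parts 1 - t and t up to sign, so squared
    -- norms multiply and neither factor vanishes.
    coefficients≉0 : ∀ {a b} → a · a + b · b ≈ ((1# - t) · (1# - t) + t · t) · (α · α + β · β) →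
                     ¬ (a ≈ 0# × b ≈ 0#)
    coefficients≉0 norm (a≈0 , b≈0) = irrefl
      (trans (sym (trans (+-cong (*-cong a≈0 a≈0) (*-cong b≈0 b≈0)) (solve 0 (:0 :* :0 :+ :0 :* :0 := :0) refl))) norm)
      (0<* (0<x²+y² (1-t,t≉0 t)) (0<x²+y² α,β≉0))

    frontLine sideLine : Carrier → Line
    frontLine s = line ((1# - t) · α + t · (- β)) ((1# - t) · β + t · α) s
      (coefficients≉0 (solve 3 (λ α β t → let a = (:1 :- t) :* α :+ t :* (:- β) ; b = (:1 :- t) :* β :+ t :* α in
        a :* a :+ b :* b := ((:1 :- t) :* (:1 :- t) :+ t :* t) :* (α :* α :+ β :* β)) refl α β t))
    sideLine s = line ((1# - t) · (- β) - t · α) ((1# - t) · α - t · β) s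
      (coefficients≉0 (solve 3 (λ α β t → let a = (:1 :- t) :* (:- β) :- t :* α ; b = (:1 :- t) :* α :- t :* β in
        a :* a :+ b :* b := ((:1 :- t) :* (:1 :- t) :+ t :* t) :* (α :* α :+ β :* β)) refl α β t))

    perpendicular : ∀ s u → Perpendicular (sideLine u) (frontLine s)
    perpendicular s u = solve 3 (λ α β t →
      ((:1 :- t) :* (:- β) :- t :* α) :* ((:1 :- t) :* α :+ t :* (:- β))
        :+ ((:1 :- t) :* α :- t :* β) :* ((:1 :- t) :* β :+ t :* α)
      := :0) refl α β t

  module _ (P : List Point) (0<n : 0 ℕ.< length P) (R : AffineMap)
    (involution : Involution R) (reversing : OrientationReversing R) (invariant : Invariant R P)
    (k : ℕ) (k≤n/4 : k ≤ length P / 4)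
    where

    h : ℕ
    h = (length P ∸ 2 * k) / 2

    Conclusion : Set _
    Conclusion = ∃₂ λ (l m : Line) → Perpendicular l m
      × count l m I P ≤ k × count l m II P ≤ k × count l m III P ≤ h × count l m IV P ≤ h

    module _ {α β : Carrier} (swaps : SwapsAxes R involution reversing α β)
      {N⁻¹ : Carrier} (0<N⁻¹ : 0# < N⁻¹) (N*N⁻¹≈1 : (α · α + β · β) · N⁻¹ ≈ 1#) where
      open Coordinates R involution reversing swaps 0<N⁻¹ N*N⁻¹≈1
      open Rotation ℝ X Y P k h (k≤n/4⇒k+k<n k≤n/4 0<n) (n≤2k+1+2h k (length P))

      open Mirror (apply R) γ δ e₁ e₂ 0<γ 0<δ X∘R Y∘R
        (λ Q? Q-resp → ≡.trans (≡.sym (#-map Q? (apply R) P))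
          (xs↭ys⇒|xs|≡|ys| pointSetoid (filter⁺ pointSetoid Q?
            (λ p≈q → Q-resp (X-cong p≈q) (Y-cong p≈q)) invariant)))
        using (bisected)

      -- With the side line as `l` and the front line as `m`, sectors `I` and `II` make up the
      -- front, `III` and `IV` the back, which gives the cyclic order k, k, h, h.
      lines : ∃ Bisected → Conclusion
      lines (t , s , u , (front>u , front<u) , (back>u , back<u)) =
        l , m , perpendicular s u ,
        ℕ.≤-trans (#-mono (inSector? l m I) (front? t s ∩? above? (g t) u) P
          (λ {p} _ (a , b) → <-respʳ-≈ (m≈f p) b , <-respʳ-≈ (l≈g p) a)) front>u ,
        ℕ.≤-trans (#-mono (inSector? l m II) (front? t s ∩? below? (g t) u) P
          (λ {p} _ (a , b) → <-respʳ-≈ (m≈f p) b , <-respˡ-≈ (l≈g p) a)) front<u ,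
        ℕ.≤-trans (#-mono (inSector? l m III) (back? t s ∩? below? (g t) u) P
          (λ {p} _ (a , b) → <-respˡ-≈ (m≈f p) b , <-respˡ-≈ (l≈g p) a)) back<u ,
        ℕ.≤-trans (#-mono (inSector? l m IV) (back? t s ∩? above? (g t) u) P
          (λ {p} _ (a , b) → <-respˡ-≈ (m≈f p) b , <-respʳ-≈ (l≈g p) a)) back>u
        where
        open TurnedLines α β t (proj₁ swaps)
        l m : Line
        l = sideLine u
        m = frontLine s

        m≈f : ∀ p → Line.α m · proj₁ p + Line.β m · proj₂ p ≈ f t p
        m≈f (x , y) = solve 5 (λ α β t x y →
          ((:1 :- t) :* α :+ t :* (:- β)) :* x :+ ((:1 :- t) :* β :+ t :* α) :* y
          := (:1 :- t) :* (α :* x :+ β :* y) :+ t :* ((:- β) :* x :+ α :* y)) refl α β t x y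

        l≈g : ∀ p → Line.α l · proj₁ p + Line.β l · proj₂ p ≈ g t p
        l≈g (x , y) = solve 5 (λ α β t x y →
          ((:1 :- t) :* (:- β) :- t :* α) :* x :+ ((:1 :- t) :* α :- t :* β) :* y
          := (:1 :- t) :* ((:- β) :* x :+ α :* y) :- t :* (α :* x :+ β :* y)) refl α β t x y

      conclusion : Conclusion
      conclusion = lines bisected

    perpendicular-lines : Conclusion
    perpendicular-lines = from-axes (swapped-axes R involution reversing)
      where
      from-reciprocal : ∀ {α β} (swaps : SwapsAxes R involution reversing α β) →
        ∃[ r ] 0# < r × (α · α + β · β) · r ≈ 1# → Conclusion
      from-reciprocal swaps (_ , 0<r , N*r≈1) = conclusion swaps 0<r N*r≈1
      from-axes : ∃[ α ] ∃[ β ] SwapsAxes R involution reversing α β → Conclusion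
      from-axes (_ , _ , swaps) = from-reciprocal swaps (reciprocal (0<x²+y² (proj₁ swaps)))

corollary1p7 : ∀ {c ℓ₁ ℓ₂ : Level} (ℝ : CompleteOrderedField c ℓ₁ ℓ₂) →
    let open Plane ℝ in
    (P : List Point) (R : AffineMap) →
    Involution R → OrientationReversing R → Invariant R P →
    (k : ℕ) → k ≤ length P / 4 →
    ∃₂ λ (l m : Line) →
    Perpendicular l m
    × count l m I P ≤ k
    × count l m II P ≤ k
    × count l m III P ≤ (length P ∸ 2 * k) / 2
    × count l m IV P ≤ (length P ∸ 2 * k) / 2
corollary1p7 ℝ [] R involution reversing invariant k k≤n/4 =
  -- Without points there is no value to cut at, and any perpendicular pair serves; the axis is (1 -
  -- 0 , 0).
  sideLine 0# , frontLine 0# , perpendicular 0# 0# , z≤n , z≤n , z≤n , z≤n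
  where
  open CompleteOrderedField ℝ using (0#)
  open PerpendicularLines.TurnedLines ℝ _ _ 0# (OrderedField.1-t,t≉0 ℝ 0#)
corollary1p7 ℝ P@(_ ∷ _) R involution reversing invariant k k≤n/4 =
  PerpendicularLines.perpendicular-lines ℝ P (s≤s z≤n) R involution reversing invariant k k≤n/4
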